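{- Fix an integer $\overline{m}\geq 1$ and put $m=2\overline{m}$. For each integer $n\geq 2$ let $G_n=([n],A,1,2)$ be the doubly-rooted digraph with roots $s=1$, $t=2$ and edges $a_1,\dots,a_{m+4n-5}$ given (writing $a_x=(i,j)$ for $a_x^-=i$, $a_x^+=j$) by: $a_{2\ell-1}=(1,2)$ and $a_{2\ell}=(2,1)$ for $\ell=1,\dots,\overline{m}$; $a_{m+1}=(1,1)$; $a_{m+2}=(1,2)$; for $h=3,\dots,n$: $a_{m+4h-9}=(h-1,h)$, $a_{m+4h-8}=(h,1)$, $a_{m+4h-7}=(1,h)$, $a_{m+4h-6}=(h,h-1)$; and $a_{m+4n-5}=(n,n)$. Let $B=\{a_1,\dots,a_m\}$. Then, with respect to the enumeration $(a_1,\dots,a_{m+4n-5})$, \[S(G_n,B)=\begin{cases}\big((\overline{m}+1)!\big)^2 & \text{if } n=2,\\ \tfrac{2}{3}\,\overline{m}\,(\overline{m}+n-1)!\,\overline{m}! & \text{if } n\geq 3.\end{cases}\]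
   Context: A doubly-rooted digraph $G=(V,A,s,t)$: finite vertex set $V$, finite edge set $A$, each edge $a$ with source $a^-$ and target $a^+$ (loops and multiple edges allowed), roots $s,t\in V$. For an enumeration $A=\{a_1,\dots,a_k\}$ and $B\subseteq A$: $M(B)=\{j\in[k]:a_j\in B\}$; $P(G)=\{\sigma\in\mathfrak{S}_k: a_{\sigma(1)}^-=s,\ a_{\sigma(k)}^+=t,\ a_{\sigma(j+1)}^-=a_{\sigma(j)}^+\ \forall j\in[k-1]\}$; for $M=\{j_1<\dots<j_\ell\}\subseteq[k]$ and $\sigma\in\mathfrak{S}_k$, $\sigma_M\in\mathfrak{S}_\ell$ is $\sigma_M(g)=|\{h\in[\ell]:\sigma(j_h)\le\sigma(j_g)\}|$; and $S(G,B)=\sum_{\sigma\in P(G)}\mathrm{sgn}(\sigma)\mathrm{sgn}(\sigma_{M(B)})$.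
   Formalization: In S(G,B) the second sign is that of the inverse permutation restricted to M(B) (the order in which the trail visits the edges of B) instead of σ_{M(B)}; with σ_{M(B)} read literally the sum is −2, not 4, for m̄=1, n=2. -}

module Defs where

open import Data.Fin as Fin using (Fin; zero; suc; toℕ; fromℕ; fromℕ<; inject₁; punchOut)
open import Data.Fin.Permutation as Perm using (Permutation′; _⟨$⟩ʳ_)
open import Data.Fin.Properties using (all?; any?; injective⇒≤; punchIn-injective; punchOut-injective; toℕ-fromℕ<; <-cmp; suc-injective)
open import Data.Fin.Subset using (Subset; inside; outside; ∣_∣; _∈_)
open import Data.Fin.Subset.Properties using (∣p∣≤n; p⊂q⇒∣p∣<∣q∣; p⊆q⇒∣p∣≤∣q∣; ∣⁅x⁆∣≡1; x∈⁅y⁆⇒x≡y)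
open import Data.Integer.Base as ℤ using (ℤ; 0ℤ; -1ℤ)
open import Data.List.Base using (List; []; _∷_; allFin; cartesianProductWith; filter; foldr; map)
open import Data.List.Membership.Propositional.Properties using (∈-allFin)
import Data.List.Membership.Setoid as Membership
import Data.List.Membership.Setoid.Properties as Membershipₚ
open import Data.List.Relation.Unary.All using ([])
open import Data.List.Relation.Unary.AllPairs using ([]; _∷_)
open import Data.List.Relation.Unary.Any using (here)
import Data.List.Relation.Unary.Unique.Setoid as Uniqueness
import Data.List.Relation.Unary.Unique.Setoid.Properties as Uniquenessₚ
open import Data.List.Relation.Unary.Unique.Propositional.Properties using (allFin⁺)
open import Data.Nat.Base as ℕ using (ℕ; zero; suc; pred; _+_; _*_; _∸_; NonTrivial)
open import Data.Nat.ListAction using (sum)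
import Data.Nat.Properties as ℕ
open import Data.Nat.Tactic.RingSolver using (solve-∀)
open import Data.Product.Base using (∃; _×_; _,_; proj₁; proj₂)
open import Data.Vec.Base as Vec using (Vec; []; _∷_; _++_; concat; lookup; replicate; tabulate)
open import Data.Vec.Properties using (lookup∘tabulate; lookup⇒[]=; []=⇒lookup)
open import Function.Base using (_∘_)
open import Function.Definitions using (Injective)
open import Level using (0ℓ)
open import Relation.Binary.Bundles using (Setoid)
open import Relation.Binary.Definitions using (tri<; tri≈; tri>)
open import Relation.Binary.PropositionalEquality
open import Relation.Nullary.Decidable using (yes; no; does; dec-true; _×-dec_; _→-dec_)
open import Relation.Nullary.Negation using (contradiction)
open import Relation.Unary using (Pred; Decidable)

-- Throughout, Fin k stands for [k] = {1,…,k}: the index i : Fin k is the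
-- number toℕ i + 1.

⟨_⟩ : ∀ {k} {P : Pred (Fin k) 0ℓ} → Decidable P → Subset k
⟨ P? ⟩ = tabulate (does ∘ P?)

module _ {k} {P : Pred (Fin k) 0ℓ} (P? : Decidable P) where

  ∈⟨⟩⁺ : ∀ {i} → P i → i ∈ ⟨ P? ⟩
  ∈⟨⟩⁺ {i} p = lookup⇒[]= i _ (trans (lookup∘tabulate _ i) (dec-true (P? i) p))

  ∈⟨⟩⁻ : ∀ {i} → i ∈ ⟨ P? ⟩ → P i
  ∈⟨⟩⁻ {i} i∈ with P? i | trans (sym (lookup∘tabulate (does ∘ P?) i)) ([]=⇒lookup i∈)
  ... | yes p | _ = p
  ... | no _  | ()

permutations : ∀ k → List (Permutation′ k)
permutations zero    = Perm.id ∷ []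
permutations (suc k) = cartesianProductWith (Perm.insert zero) (allFin (suc k)) (permutations k)

-- Equality of permutations is pointwise equality, Perm._≈_; by
-- permutations-complete and permutations-unique, the list above contains
-- each element of 𝔖ₖ exactly once for it.

Perm-setoid : ℕ → Setoid 0ℓ 0ℓ
Perm-setoid k = record
  { Carrier       = Permutation′ k
  ; _≈_           = Perm._≈_
  ; isEquivalence = record
    { refl  = λ _ → refl
    ; sym   = λ p i → sym (p i)
    ; trans = λ p q i → trans (p i) (q i)
    }
  }

private
  insert-cong : ∀ {k} {i j : Fin (suc k)} {π ρ : Permutation′ k} → i ≡ j → π Perm.≈ ρ →
                Perm.insert zero i π Perm.≈ Perm.insert zero j ρ
  insert-cong refl π≈ρ zero    = refl
  insert-cong {i = i} {π = π} {ρ} refl π≈ρ (suc l) = trans (Perm.insert-punchIn zero i π l)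
    (trans (cong (Fin.punchIn i) (π≈ρ l)) (sym (Perm.insert-punchIn zero i ρ l)))

  insert-injective : ∀ {k} {i j : Fin (suc k)} {π ρ : Permutation′ k} →
                     Perm.insert zero i π Perm.≈ Perm.insert zero j ρ → i ≡ j × π Perm.≈ ρ
  insert-injective {i = i} {π = π} {ρ} eq with eq zero
  ... | refl = refl , λ l → punchIn-injective i _ _
    (trans (sym (Perm.insert-punchIn zero i π l)) (trans (eq (suc l)) (Perm.insert-punchIn zero i ρ l)))

permutations-complete : ∀ {k} (π : Permutation′ k) → Membership._∈_ (Perm-setoid k) π (permutations k)
permutations-complete {zero}  π = here λ ()
permutations-complete {suc k} π =
  Membershipₚ.∈-resp-≈ (Perm-setoid (suc k))
    {x = Perm.insert zero (π ⟨$⟩ʳ zero) (Perm.remove zero π)} {y = π} (Perm.insert-remove zero π)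
    (Membershipₚ.∈-cartesianProductWith⁺ (setoid _) (Perm-setoid k) (Perm-setoid (suc k)) {f = Perm.insert zero}
      (λ {i} {j} {π} {ρ} → insert-cong {π = π} {ρ})
      (∈-allFin (π ⟨$⟩ʳ zero)) (permutations-complete (Perm.remove zero π)))

permutations-unique : ∀ k → Uniqueness.Unique (Perm-setoid k) (permutations k)
permutations-unique zero    = [] ∷ []
permutations-unique (suc k) =
  Uniquenessₚ.cartesianProductWith⁺ (setoid _) (Perm-setoid k) (Perm-setoid (suc k)) (Perm.insert zero)
    (λ {i} {j} {π} {ρ} → insert-injective {π = π} {ρ}) (allFin⁺ (suc k)) (permutations-unique k)

inversions : ∀ {k} → Permutation′ k → ℕ
inversions {k} σ = sum (map (λ i → ∣ ⟨ (λ j → (i Fin.<? j) ×-dec ((σ ⟨$⟩ʳ j) Fin.<? (σ ⟨$⟩ʳ i))) ⟩ ∣) (allFin k))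

sgn : ∀ {k} → Permutation′ k → ℤ
sgn σ = -1ℤ ℤ.^ inversions σ

private
  surjective : ∀ {k} (f : Fin k → Fin k) → Injective _≡_ _≡_ f → ∀ y → ∃ λ x → f x ≡ y
  surjective {suc k} f inj y with any? (λ x → f x Fin.≟ y)
  ... | yes p = p
  ... | no ¬p = contradiction
    (injective⇒≤ {f = λ x → punchOut {i = y} {f x} (λ y≡fx → ¬p (x , sym y≡fx))}
      (λ {a} {b} eq → inj (punchOut-injective (λ e → ¬p (a , sym e)) (λ e → ¬p (b , sym e)) eq)))
    ℕ.1+n≰n

fromInjection : ∀ {k} (f : Fin k → Fin k) → Injective _≡_ _≡_ f → Permutation′ k
fromInjection f inj = Perm.permutation f (proj₁ ∘ surjective f inj)
  (proj₂ ∘ surjective f inj)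
  (λ x → inj (proj₂ (surjective f inj (f x))))

-- nth M enumerates M increasingly: for M = {j₁ < … < j_ℓ}, it is g ↦ j_g.
nth : ∀ {k} (M : Subset k) → Fin ∣ M ∣ → Fin k
nth (inside  ∷ M) zero    = zero
nth (inside  ∷ M) (suc g) = suc (nth M g)
nth (outside ∷ M) g       = suc (nth M g)

nth-injective : ∀ {k} (M : Subset k) → Injective _≡_ _≡_ (nth M)
nth-injective (inside  ∷ M) {zero}  {zero}  eq = refl
nth-injective (inside  ∷ M) {suc g} {suc h} eq = cong suc (nth-injective M (suc-injective eq))
nth-injective (outside ∷ M) eq = nth-injective M (suc-injective eq)

module Restriction {k} (σ : Permutation′ k) (M : Subset k) where

  value : Fin ∣ M ∣ → Fin k
  value g = σ ⟨$⟩ʳ nth M g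

  -- |{h ∈ [ℓ] : σ(j_h) ≤ σ(j_g)}|, a number in {1,…,ℓ}.
  rank : Fin ∣ M ∣ → ℕ
  rank g = ∣ ⟨ (λ h → value h Fin.≤? value g) ⟩ ∣

  value-injective : Injective _≡_ _≡_ value
  value-injective eq = nth-injective M (Perm-injective eq)
    where
    Perm-injective : Injective _≡_ _≡_ (σ ⟨$⟩ʳ_)
    Perm-injective {i} {j} eq = trans (sym (Perm.inverseˡ σ)) (trans (cong (σ Perm.⟨$⟩ˡ_) eq) (Perm.inverseˡ σ))

  rank>0 : ∀ g → 0 ℕ.< rank g
  rank>0 g = subst (ℕ._≤ rank g) (∣⁅x⁆∣≡1 g)
    (p⊆q⇒∣p∣≤∣q∣ λ x∈ → ∈⟨⟩⁺ (λ h → value h Fin.≤? value g) (ℕ.≤-reflexive (cong (toℕ ∘ value) (x∈⁅y⁆⇒x≡y g x∈))))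

  suc-pred-rank : ∀ g → suc (pred (rank g)) ≡ rank g
  suc-pred-rank g with rank g | rank>0 g
  ... | suc _ | _ = refl

  pred-rank< : ∀ g → pred (rank g) ℕ.< ∣ M ∣
  pred-rank< g = subst (ℕ._≤ ∣ M ∣) (sym (suc-pred-rank g)) (∣p∣≤n ⟨ (λ h → value h Fin.≤? value g) ⟩)

  rank-mono : ∀ {g h} → value g Fin.< value h → rank g ℕ.< rank h
  rank-mono {g} {h} g<h = p⊂q⇒∣p∣<∣q∣
    ( (λ x∈ → ∈⟨⟩⁺ (λ x → value x Fin.≤? value h) (ℕ.≤-trans (∈⟨⟩⁻ (λ x → value x Fin.≤? value g) x∈) (ℕ.<⇒≤ g<h)))
    , h
    , ∈⟨⟩⁺ (λ x → value x Fin.≤? value h) ℕ.≤-refl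
    , λ h∈ → ℕ.<⇒≱ g<h (∈⟨⟩⁻ (λ x → value x Fin.≤? value g) h∈)
    )

  rank-injective : Injective _≡_ _≡_ rank
  rank-injective {g} {h} eq with <-cmp (value g) (value h)
  ... | tri< g<h _ _ = contradiction eq (ℕ.<⇒≢ (rank-mono g<h))
  ... | tri≈ _ g≡h _ = value-injective g≡h
  ... | tri> _ _ h<g = contradiction (sym eq) (ℕ.<⇒≢ (rank-mono h<g))

  to : Fin ∣ M ∣ → Fin ∣ M ∣
  to g = fromℕ< (pred-rank< g)

  toℕ-to : ∀ g → suc (toℕ (to g)) ≡ rank g
  toℕ-to g = trans (cong suc (toℕ-fromℕ< (pred-rank< g))) (suc-pred-rank g)

  to-injective : Injective _≡_ _≡_ to
  to-injective {g} {h} eq = rank-injective (trans (sym (toℕ-to g)) (trans (cong (suc ∘ toℕ) eq) (toℕ-to h)))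

infix 9 _↾_

_↾_ : ∀ {k} → Permutation′ k → (M : Subset k) → Permutation′ ∣ M ∣
σ ↾ M = fromInjection to to-injective
  where open Restriction σ M

-- The edges come enumerated as a₁,…,a_k, so the edge set is [k] itself and
-- M(B) = B for a set B of edges.
record DoublyRootedDigraph : Set where
  field
    #V #A  : ℕ
    source : Fin #A → Fin #V
    target : Fin #A → Fin #V
    s t    : Fin #V

module _ (G : DoublyRootedDigraph) where

  open DoublyRootedDigraph G

  P : Permutation′ #A → Set
  P σ = (∀ j → toℕ j ≡ 0 → source (σ ⟨$⟩ʳ j) ≡ s)
      × (∀ j → suc (toℕ j) ≡ #A → target (σ ⟨$⟩ʳ j) ≡ t)
      × (∀ i j → toℕ j ≡ suc (toℕ i) → source (σ ⟨$⟩ʳ j) ≡ target (σ ⟨$⟩ʳ i))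

  P? : Decidable P
  P? σ = all? (λ j → (toℕ j ℕ.≟ 0) →-dec (source (σ ⟨$⟩ʳ j) Fin.≟ s))
   ×-dec all? (λ j → (suc (toℕ j) ℕ.≟ #A) →-dec (target (σ ⟨$⟩ʳ j) Fin.≟ t))
   ×-dec all? (λ i → all? (λ j → (toℕ j ℕ.≟ suc (toℕ i)) →-dec (source (σ ⟨$⟩ʳ j) Fin.≟ target (σ ⟨$⟩ʳ i))))

  -- A permutation σ ∈ P(G) sends positions along the trail to edge labels,
  -- while M(B) is a set of edge labels, so it is σ⁻¹ (edge ↦ its position)
  -- that is restricted to M(B): the second sign is that of the order in
  -- which the trail visits the edges in B.  Restricting σ itself would
  -- single out the positions in M(B), whichever edges occupy them
  -- (and would give -2 instead of 4 for Gₙ 1 2 and B = {a₁,a₂}).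
  S : Subset #A → ℤ
  S B = foldr ℤ._+_ 0ℤ (map (λ σ → sgn σ ℤ.* sgn (Perm.flip σ ↾ B)) (filter P? (permutations #A)))

-- Here n = 2 + r.
edges : ∀ m̄ r → Vec (Fin (2 + r) × Fin (2 + r)) (m̄ * 2 + (2 + (r * 4 + 1)))
edges m̄ r =
     concat (replicate m̄ ((v₁ , v₂) ∷ (v₂ , v₁) ∷ []))
  ++ (v₁ , v₁) ∷ (v₁ , v₂) ∷ []
  ++ concat (tabulate λ i → (pre i , cur i) ∷ (cur i , v₁) ∷ (v₁ , cur i) ∷ (cur i , pre i) ∷ [])
  ++ (vₙ , vₙ) ∷ []
  where
  v₁ v₂ vₙ : Fin (2 + r)
  v₁ = zero
  v₂ = suc zero
  vₙ = fromℕ (suc r)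
  -- The vertices h and h-1, where h = toℕ i + 3 runs through 3,…,n.
  cur pre : Fin r → Fin (2 + r)
  cur i = suc (suc i)
  pre i = suc (inject₁ i)

Gₙ : (m̄ n : ℕ) .{{_ : NonTrivial n}} → DoublyRootedDigraph
Gₙ m̄ (suc (suc r)) = record
  { #V     = 2 + r
  ; #A     = m̄ * 2 + (2 + (r * 4 + 1))
  ; source = proj₁ ∘ lookup (edges m̄ r)
  ; target = proj₂ ∘ lookup (edges m̄ r)
  ; s      = zero
  ; t      = suc zero
  }

#A-Gₙ : ∀ m̄ n .{{_ : NonTrivial n}} → DoublyRootedDigraph.#A (Gₙ m̄ n) ≡ 2 * m̄ + 4 * n ∸ 5
#A-Gₙ m̄ (suc (suc r)) = sym (trans (cong (_∸ 5) (eq m̄ r)) (ℕ.m+n∸m≡n 5 _))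
  where
  eq : ∀ m̄ r → 2 * m̄ + 4 * suc (suc r) ≡ 5 + (m̄ * 2 + (2 + (r * 4 + 1)))
  eq = solve-∀

firstEdges : (G : DoublyRootedDigraph) → ℕ → Subset (DoublyRootedDigraph.#A G)
firstEdges G m = ⟨ (λ x → toℕ x ℕ.<? m) ⟩

{-# OPTIONS --safe #-}
module Submission where

-- The product of the two signs is multiplicative over pairs of edges: two
-- edges from B commute, and all other pairs anticommute.  So S(G, B) is a
-- signed count of Eulerian trails with edges graded by ℤ/2 × ℤ/2.  In such a
-- count an edge may be glued to its successor (or predecessor) in all possible
-- ways, the count vanishes when there are two parallel edges of equal grade
-- that anticommute, and a loop of grade 0 only contributes the number of visits
-- of its vertex.
--
-- For n ≥ 3 gluing removes the vertex n, with four terms.  One is (m̄+n-1)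
-- S(Gₙ₋₁, B); the others have parallel anticommuting edges, except for one term
-- when n = 3.  What remains are counts on the vertices 1 and 2, where gluing
-- an edge (1,2) of B to an edge (2,1) of B gives a loop of grade 0, so that
-- the edges of B can be removed one pair at a time.

open import Defs
import Algebra.Properties.Semiring.Sum as SemiringSum
open import Data.Bool.Base using (Bool; true; false; not; _∧_; _xor_; if_then_else_)
import Data.Bool.Properties as Boolₚ
open import Data.Fin.Base as Fin using (Fin; zero; suc; toℕ; punchIn; inject₁)
open import Data.Fin.Permutation as Perm using (Permutation′; _⟨$⟩ʳ_; _⟨$⟩ˡ_)
open import Data.Fin.Properties as Finₚ using (<-cmp)
open import Data.Fin.Subset using (Subset; inside; outside; ∣_∣)
open import Data.Integer.Base using (+_)
open import Data.Integer.Base using (ℤ; 0ℤ; 1ℤ; -1ℤ) renaming (_+_ to _+ᶻ_; _*_ to _*ᶻ_; _^_ to _^ᶻ_)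
import Data.Integer.Properties as ℤₚ
open import Data.Integer.Tactic.RingSolver using (solve-∀)
open import Data.List.Base as List using (List; []; _∷_; _++_; replicate; length; foldr; map; allFin; filter; cartesianProductWith)
open import Data.List.Membership.Propositional using () renaming (_∈_ to _∈ˡ_)
open import Data.List.Membership.Propositional.Properties using (∈-∃++)
import Data.List.Properties as Listₚ
open import Data.List.Relation.Unary.All as All using (All; []; _∷_)
import Data.List.Relation.Unary.All.Properties as Allₚ
open import Data.List.Relation.Unary.Any using (here; there)
open import Data.Nat.Base using (zero; suc; pred; _≡ᵇ_; _<ᵇ_; _<_; z≤n; s≤s)
open import Data.Nat.Base using (ℕ; _+_; _*_; _∸_; _^_; _!; _≥_; NonZero; NonTrivial)
import Data.Nat.ListAction as ℕList
import Data.Nat.Properties as ℕₚ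
open import Data.Product.Base using (_×_; _,_)
import Data.Rational.Base as ℚ
import Data.Rational.Properties as ℚₚ
import Data.Rational.Unnormalised.Base as ℚᵘ
import Data.Rational.Unnormalised.Properties as ℚᵘₚ
open import Data.Sum.Base using (_⊎_; inj₁; inj₂)
open import Data.Vec.Base as Vec using (Vec; []; _∷_)
import Data.Vec.Properties as Vecₚ
open import Function.Base using (_∘_; id)
open import Function.Bundles using (mk⇔)
open import Relation.Binary.Definitions using (tri<; tri≈; tri>)
open import Relation.Binary.PropositionalEquality using (_≡_)
open import Relation.Binary.PropositionalEquality using (_≢_; refl; sym; trans; cong; cong₂; subst₂; module ≡-Reasoning)
open import Relation.Nullary.Decidable using (does-⇔; yes; no)
open import Relation.Nullary.Negation using (¬_; contradiction)
open import Relation.Unary using (Decidable)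

open ≡-Reasoning
open SemiringSum ℕₚ.+-*-semiring using (sum; sum-cong-≗; ∑-comm; sum-permute; *-distribˡ-sum; sum-replicate-zero)

-- The sign of exchanging two glued edges is the product over the pairs of their constituents. It
-- depends only on the parities `β` and `ω`, because the exchange sign is a bilinear form on grades;
-- so glued edges can be treated as edges, and all four grades occur although single edges have only
-- two. The edge to glue and the direction are chosen so that most of the resulting edges either
-- duplicate an anticommuting edge or are loops of grade 0.
--
-- The formula changes at n = 3 because the term left over by the elimination contains an edge (h,1)
-- outside `B`, where h = n-1. For h ≥ 3 it duplicates an edge of the digraph, but for h = 2 all
-- other edges (2,1) lie in `B`. The denominator 3 is 3!/2: removing a pairs of edges of `B` beside
-- k loops at vertex 1 gives the factor a!(k+a)!/k!, one of the counts has k = 3, and its three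
-- loops have 2 signed orderings. Denominators are cleared, so that all these identities live in ℤ.

-- β and ω are the parities of the numbers of edges from B and not from B in a
-- composite edge; vertices are counted from 0.
record Edge : Set where
  constructor edge
  field
    src tgt : ℕ
    β ω     : Bool

open Edge

infixr 7 _·_

_·_ : Edge → Edge → Edge
e · f = edge (src e) (tgt f) (β e xor β f) (ω e xor ω f)

-- The exchange sign as a form on grades

sign : Bool → ℤ
sign false = 1ℤ
sign true  = -1ℤ

-- The sign of exchanging two consecutive edges: edges from B commute with each
-- other, all other pairs anticommute.
ε : Edge → Edge → ℤ
ε e f = sign (ω e ∧ ω f) *ᶻ (sign (β e ∧ ω f) *ᶻ sign (ω e ∧ β f))

sign² : ∀ x → sign x *ᶻ sign x ≡ 1ℤ
sign² false = refl
sign² true  = refl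

sign-comm-∧ : ∀ x y → sign (x ∧ y) ≡ sign (y ∧ x)
sign-comm-∧ false false = refl
sign-comm-∧ false true  = refl
sign-comm-∧ true  false = refl
sign-comm-∧ true  true  = refl

sign-∧-xor : ∀ x y z → sign (x ∧ (y xor z)) ≡ sign (x ∧ y) *ᶻ sign (x ∧ z)
sign-∧-xor false y     z     = refl
sign-∧-xor true  false z     = sym (ℤₚ.*-identityˡ _)
sign-∧-xor true  true  false = refl
sign-∧-xor true  true  true  = refl

ε-sym : ∀ e f → ε e f ≡ ε f e
ε-sym e f = cong₂ _*ᶻ_ (sign-comm-∧ (ω e) (ω f))
  (trans (cong₂ _*ᶻ_ (sign-comm-∧ (β e) (ω f)) (sign-comm-∧ (ω e) (β f))) (ℤₚ.*-comm (sign (ω f ∧ β e)) _))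

ε² : ∀ e f → ε e f *ᶻ ε e f ≡ 1ℤ
ε² e f = trans (lem a b c) (cong₂ _*ᶻ_ (sign² (ω e ∧ ω f)) (cong₂ _*ᶻ_ (sign² (β e ∧ ω f)) (sign² (ω e ∧ β f))))
  where
  a = sign (ω e ∧ ω f)
  b = sign (β e ∧ ω f)
  c = sign (ω e ∧ β f)
  lem : ∀ a b c → (a *ᶻ (b *ᶻ c)) *ᶻ (a *ᶻ (b *ᶻ c)) ≡ (a *ᶻ a) *ᶻ ((b *ᶻ b) *ᶻ (c *ᶻ c))
  lem = solve-∀

-- Bilinearity of the form: passing a glued edge costs the same sign as passing its two constituents
-- one after the other.
ε-· : ∀ e f g → ε e (f · g) ≡ ε e f *ᶻ ε e g
ε-· e f g = trans
  (cong₂ _*ᶻ_ (sign-∧-xor (ω e) (ω f) (ω g)) (cong₂ _*ᶻ_ (sign-∧-xor (β e) (ω f) (ω g)) (sign-∧-xor (ω e) (β f) (β g))))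
  (lem (sign (ω e ∧ ω f)) (sign (ω e ∧ ω g)) (sign (β e ∧ ω f)) (sign (β e ∧ ω g)) (sign (ω e ∧ β f)) (sign (ω e ∧ β g)))
  where
  lem : ∀ a a′ b b′ c c′ → (a *ᶻ a′) *ᶻ ((b *ᶻ b′) *ᶻ (c *ᶻ c′)) ≡ (a *ᶻ (b *ᶻ c)) *ᶻ (a′ *ᶻ (b′ *ᶻ c′))
  lem = solve-∀

εs : Edge → List Edge → ℤ
εs e []       = 1ℤ
εs e (f ∷ fs) = ε e f *ᶻ εs e fs

-- Signed sums over the removal of one edge

-- ∑∖ es φ is the sum of ± φ f (es ∖ f) over the entries f of es, with the
-- sign of moving f to the front of es.
∑∖ : List Edge → (Edge → List Edge → ℤ) → ℤ
∑∖ []       φ = 0ℤ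
∑∖ (e ∷ es) φ = φ e es +ᶻ ∑∖ es (λ f fs → ε f e *ᶻ φ f (e ∷ fs))

∑∖-cong : ∀ es {φ ψ} → (∀ f fs → φ f fs ≡ ψ f fs) → ∑∖ es φ ≡ ∑∖ es ψ
∑∖-cong []       eq = refl
∑∖-cong (e ∷ es) eq = cong₂ _+ᶻ_ (eq e es) (∑∖-cong es λ f fs → cong (ε f e *ᶻ_) (eq f (e ∷ fs)))

∑∖-+ : ∀ es φ ψ → ∑∖ es (λ f fs → φ f fs +ᶻ ψ f fs) ≡ ∑∖ es φ +ᶻ ∑∖ es ψ
∑∖-+ []       φ ψ = refl
∑∖-+ (e ∷ es) φ ψ = begin
  (φ e es +ᶻ ψ e es) +ᶻ ∑∖ es (λ f fs → ε f e *ᶻ (φ f (e ∷ fs) +ᶻ ψ f (e ∷ fs)))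
    ≡⟨ cong ((φ e es +ᶻ ψ e es) +ᶻ_) (trans (∑∖-cong es λ f fs → ℤₚ.*-distribˡ-+ (ε f e) _ _) (∑∖-+ es _ _)) ⟩
  (φ e es +ᶻ ψ e es) +ᶻ (∑∖ es _ +ᶻ ∑∖ es _)
    ≡⟨ lem (φ e es) _ _ _ ⟩
  _ ∎
  where
  lem : ∀ a b c d → (a +ᶻ b) +ᶻ (c +ᶻ d) ≡ (a +ᶻ c) +ᶻ (b +ᶻ d)
  lem = solve-∀

*-exchange : ∀ a b c → a *ᶻ (b *ᶻ c) ≡ b *ᶻ (a *ᶻ c)
*-exchange = solve-∀

∑∖-* : ∀ c es φ → ∑∖ es (λ f fs → c *ᶻ φ f fs) ≡ c *ᶻ ∑∖ es φ
∑∖-* c []       φ = sym (ℤₚ.*-zeroʳ c)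
∑∖-* c (e ∷ es) φ = trans
  (cong (c *ᶻ φ e es +ᶻ_) (trans (∑∖-cong es λ f fs → *-exchange (ε f e) c _) (∑∖-* c es _)))
  (sym (ℤₚ.*-distribˡ-+ c _ _))

∑∖-zero : ∀ es {φ} → (∀ f fs → φ f fs ≡ 0ℤ) → ∑∖ es φ ≡ 0ℤ
∑∖-zero []       eq = refl
∑∖-zero (e ∷ es) eq = cong₂ _+ᶻ_ (eq e es) (∑∖-zero es λ f fs → trans (cong (ε f e *ᶻ_) (eq f (e ∷ fs))) (ℤₚ.*-zeroʳ (ε f e)))

∑∖-All-zero : ∀ {P : Edge → Set} {es φ} → All P es → (∀ f fs → P f → φ f fs ≡ 0ℤ) → ∑∖ es φ ≡ 0ℤ
∑∖-All-zero []       eq = refl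
∑∖-All-zero {es = e ∷ _} (p ∷ ps) eq = cong₂ _+ᶻ_ (eq _ _ p)
  (∑∖-All-zero ps λ f fs q → trans (cong (ε f e *ᶻ_) (eq f _ q)) (ℤₚ.*-zeroʳ (ε f e)))

-- Whichever `f` is split off, the signs of `u` against `f` and against the other entries multiply
-- to the sign against all of `es`, which can be pulled out.
∑∖-εs : ∀ u es φ → ∑∖ es (λ f fs → (ε u f *ᶻ εs u fs) *ᶻ φ f fs) ≡ εs u es *ᶻ ∑∖ es φ
∑∖-εs u []       φ = refl
∑∖-εs u (e ∷ es) φ = begin
  _ ≡⟨ cong (x *ᶻ φ e es +ᶻ_) (∑∖-cong es λ f fs → lem (ε f e) (ε u f) (ε u e) (εs u fs) _) ⟩
  _ ≡⟨ cong (x *ᶻ φ e es +ᶻ_) (trans (∑∖-* (ε u e) es _) (cong (ε u e *ᶻ_) (∑∖-εs u es _))) ⟩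
  _ ≡⟨ lem′ (ε u e) (εs u es) _ _ ⟩
  _ ∎
  where
  x = ε u e *ᶻ εs u es
  lem : ∀ a b c d p → a *ᶻ ((b *ᶻ (c *ᶻ d)) *ᶻ p) ≡ c *ᶻ ((b *ᶻ d) *ᶻ (a *ᶻ p))
  lem = solve-∀
  lem′ : ∀ a b p q → (a *ᶻ b) *ᶻ p +ᶻ a *ᶻ (b *ᶻ q) ≡ (a *ᶻ b) *ᶻ (p +ᶻ q)
  lem′ = solve-∀

-- Both sides run over the ordered pairs of distinct entries; taking the two out in the other order
-- costs their exchange sign. In the induction, the terms removing `e` first on one side are those
-- removing it second on the other, and `ε²` cancels the sign that appears twice.
∑∖-swap : ∀ es (Φ : Edge → Edge → List Edge → ℤ) →
  ∑∖ es (λ r rs → ∑∖ rs (Φ r)) ≡ ∑∖ es (λ f fs → ∑∖ fs (λ r rs → ε r f *ᶻ Φ r f rs))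
∑∖-swap []       Φ = refl
∑∖-swap (e ∷ es) Φ = begin
  ∑∖ es (Φ e) +ᶻ ∑∖ es (λ r rs → ε r e *ᶻ (Φ r e rs +ᶻ ∑∖ rs (λ f fs → ε f e *ᶻ Φ r f (e ∷ fs))))
    ≡⟨ cong (∑∖ es (Φ e) +ᶻ_) (trans
         (∑∖-cong es λ r rs → trans (ℤₚ.*-distribˡ-+ (ε r e) _ _) (cong (ε r e *ᶻ Φ r e rs +ᶻ_) (sym (∑∖-* (ε r e) rs _))))
         (∑∖-+ es _ _)) ⟩
  ∑∖ es (Φ e) +ᶻ (∑∖ es (λ r rs → ε r e *ᶻ Φ r e rs) +ᶻ ∑∖ es (λ r rs → ∑∖ rs (λ f fs → ε r e *ᶻ (ε f e *ᶻ Φ r f (e ∷ fs)))))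
    ≡⟨ cong₂ (λ a b → a +ᶻ (∑∖ es (λ r rs → ε r e *ᶻ Φ r e rs) +ᶻ b))
         (∑∖-cong es λ f fs → lem₁ f (Φ e f fs))
         (trans (∑∖-swap es _) (∑∖-cong es λ f fs → trans (∑∖-cong fs λ r rs → lem₂ (ε r f) (ε r e) (ε f e) _) (∑∖-* (ε f e) fs _))) ⟩
  A +ᶻ (B +ᶻ C)
    ≡⟨ lem₃ A B C ⟩
  B +ᶻ (A +ᶻ C)
    ≡⟨ cong (B +ᶻ_) (sym (trans (∑∖-cong es λ f fs → ℤₚ.*-distribˡ-+ (ε f e) _ _) (∑∖-+ es _ _))) ⟩
  _ ∎
  where
  A = ∑∖ es (λ f fs → ε f e *ᶻ (ε e f *ᶻ Φ e f fs))
  B = ∑∖ es (λ r rs → ε r e *ᶻ Φ r e rs)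
  C = ∑∖ es (λ f fs → ε f e *ᶻ ∑∖ fs (λ r rs → ε r e *ᶻ (ε r f *ᶻ Φ r f (e ∷ rs))))
  lem₁ : ∀ f p → p ≡ ε f e *ᶻ (ε e f *ᶻ p)
  lem₁ f p = sym (trans (sym (ℤₚ.*-assoc (ε f e) _ p))
    (trans (cong (_*ᶻ p) (trans (cong (ε f e *ᶻ_) (ε-sym e f)) (ε² f e))) (ℤₚ.*-identityˡ p)))
  lem₂ : ∀ a b c p → a *ᶻ (b *ᶻ (c *ᶻ p)) ≡ c *ᶻ (b *ᶻ (a *ᶻ p))
  lem₂ = solve-∀
  lem₃ : ∀ a b c → a +ᶻ (b +ᶻ c) ≡ b +ᶻ (a +ᶻ c)
  lem₃ = solve-∀

-- Signed trail counts and the gluing of edges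

δ : ℕ → ℕ → ℤ
δ x y = if x ≡ᵇ y then 1ℤ else 0ℤ

δ-sym : ∀ a b → δ a b ≡ δ b a
δ-sym zero    zero    = refl
δ-sym zero    (suc b) = refl
δ-sym (suc a) zero    = refl
δ-sym (suc a) (suc b) = δ-sym a b

-- The signed number of orderings of es that form a trail from x to t; it
-- vanishes unless k is the length of es.
trailsₖ : ℕ → ℕ → ℕ → List Edge → ℤ
trailsₖ zero    x t []      = δ x t
trailsₖ zero    x t (_ ∷ _) = 0ℤ
trailsₖ (suc k) x t es      = ∑∖ es (λ f fs → δ (src f) x *ᶻ trailsₖ k (tgt f) t fs)

-- Either u is the last edge of the trail, or it is glued to the edge f after it.
forwardₖ : ∀ k x t u es → trailsₖ (suc k) x t (u ∷ es) ≡
  δ (tgt u) t *ᶻ (εs u es *ᶻ trailsₖ k x (src u) es)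
  +ᶻ ∑∖ es (λ f fs → δ (src f) (tgt u) *ᶻ trailsₖ k x t (u · f ∷ fs))
forwardₖ zero x t u [] = lem (src u) x (tgt u) t
  where
  lem : ∀ a x b t → δ a x *ᶻ δ b t +ᶻ 0ℤ ≡ δ b t *ᶻ (1ℤ *ᶻ δ x a) +ᶻ 0ℤ
  lem a x b t = trans (cong (λ z → z *ᶻ δ b t +ᶻ 0ℤ) (δ-sym a x)) (lem′ (δ x a) (δ b t))
    where
    lem′ : ∀ a b → a *ᶻ b +ᶻ 0ℤ ≡ b *ᶻ (1ℤ *ᶻ a) +ᶻ 0ℤ
    lem′ = solve-∀
forwardₖ zero x t u es@(_ ∷ _) = trans
  (cong₂ _+ᶻ_ (ℤₚ.*-zeroʳ (δ (src u) x)) (∑∖-zero es λ f fs → trans (cong (ε f u *ᶻ_) (ℤₚ.*-zeroʳ (δ (src f) x))) (ℤₚ.*-zeroʳ (ε f u))))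
  (sym (cong₂ _+ᶻ_ (trans (cong (δ (tgt u) t *ᶻ_) (ℤₚ.*-zeroʳ (εs u es))) (ℤₚ.*-zeroʳ (δ (tgt u) t)))
    (∑∖-zero es λ f fs → ℤₚ.*-zeroʳ (δ (src f) (tgt u)))))
forwardₖ (suc k) x t u es = begin
  δ (src u) x *ᶻ trailsₖ (suc k) (tgt u) t es
  +ᶻ ∑∖ es (λ r rs → ε r u *ᶻ (δ (src r) x *ᶻ trailsₖ (suc k) (tgt r) t (u ∷ rs)))
    ≡⟨ cong (δ (src u) x *ᶻ trailsₖ (suc k) (tgt u) t es +ᶻ_) (trans
         (∑∖-cong es λ r rs → trans (cong (λ z → ε r u *ᶻ (δ (src r) x *ᶻ z)) (forwardₖ k (tgt r) t u rs))
           (trans (lem₁ (ε r u) (δ (src r) x) (δ (tgt u) t) (εs u rs) (trailsₖ k (tgt r) (src u) rs) _)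
             (cong₂ (λ a b → (a *ᶻ εs u rs) *ᶻ (δ (tgt u) t *ᶻ (δ (src r) x *ᶻ trailsₖ k (tgt r) (src u) rs)) +ᶻ b)
               (ε-sym r u) (sym (∑∖-* (ε r u *ᶻ δ (src r) x) rs _)))))
         (trans (∑∖-+ es _ _) (cong₂ _+ᶻ_
           (trans (∑∖-εs u es _) (cong (εs u es *ᶻ_) (∑∖-* (δ (tgt u) t) es _)))
           -- The first edge `r` of the trail and the edge `f` glued to `u` are picked in the other
           -- order, which makes the sum over `f` the outer one.
           (∑∖-swap es _)))) ⟩
  δ (src u) x *ᶻ trailsₖ (suc k) (tgt u) t es +ᶻ (εs u es *ᶻ (δ (tgt u) t *ᶻ trailsₖ (suc k) x (src u) es) +ᶻ _)
    ≡⟨ lem₂ (δ (src u) x *ᶻ trailsₖ (suc k) (tgt u) t es) (εs u es) (δ (tgt u) t) (trailsₖ (suc k) x (src u) es) _ ⟩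
  δ (tgt u) t *ᶻ (εs u es *ᶻ trailsₖ (suc k) x (src u) es) +ᶻ (δ (src u) x *ᶻ trailsₖ (suc k) (tgt u) t es +ᶻ _)
    ≡⟨ cong (δ (tgt u) t *ᶻ (εs u es *ᶻ trailsₖ (suc k) x (src u) es) +ᶻ_) (trans
         (cong (_+ᶻ ∑∖ es (λ f fs → ∑∖ fs (λ r rs → ε r f *ᶻ ((ε r u *ᶻ δ (src r) x) *ᶻ (δ (src f) (tgt u) *ᶻ trailsₖ k (tgt r) t (u · f ∷ rs))))))
           (sym (∑∖-* (δ (src u) x) es _)))
         (trans (sym (∑∖-+ es _ _))
           (∑∖-cong es λ f fs → trans
             (cong₂ _+ᶻ_ (*-exchange (δ (src u) x) (δ (src f) (tgt u)) _)
               (trans (∑∖-cong fs λ r rs → trans (lem₃ (ε r f) (ε r u) (δ (src r) x) (δ (src f) (tgt u)) _)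
                   -- An `r` placed before the glued edge has passed both `u` and `f`, hence
                   -- `u · f`.
                   (cong (λ z → δ (src f) (tgt u) *ᶻ (z *ᶻ (δ (src r) x *ᶻ trailsₖ k (tgt r) t (u · f ∷ rs)))) (sym (ε-· r u f))))
                 (∑∖-* (δ (src f) (tgt u)) fs _)))
             (sym (ℤₚ.*-distribˡ-+ (δ (src f) (tgt u)) _ _))))) ⟩
  _ ∎
  where
  lem₁ : ∀ a b c d p q → a *ᶻ (b *ᶻ (c *ᶻ (d *ᶻ p) +ᶻ q)) ≡ (a *ᶻ d) *ᶻ (c *ᶻ (b *ᶻ p)) +ᶻ (a *ᶻ b) *ᶻ q
  lem₁ = solve-∀
  lem₂ : ∀ a b c d p → a +ᶻ (b *ᶻ (c *ᶻ d) +ᶻ p) ≡ c *ᶻ (b *ᶻ d) +ᶻ (a +ᶻ p)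
  lem₂ = solve-∀
  lem₃ : ∀ a b c d p → a *ᶻ ((b *ᶻ c) *ᶻ (d *ᶻ p)) ≡ d *ᶻ ((b *ᶻ a) *ᶻ (c *ᶻ p))
  lem₃ = solve-∀

-- Either u is the first edge of the trail, or it is glued to the edge f before it.
backwardₖ : ∀ k x t u es → trailsₖ (suc k) x t (u ∷ es) ≡
  δ (src u) x *ᶻ trailsₖ k (tgt u) t es
  +ᶻ ∑∖ es (λ f fs → ε f u *ᶻ (δ (tgt f) (src u) *ᶻ trailsₖ k x t (f · u ∷ fs)))
backwardₖ zero x t u es = cong (δ (src u) x *ᶻ trailsₖ zero (tgt u) t es +ᶻ_)
  (trans (∑∖-zero es λ f fs → trans (cong (ε f u *ᶻ_) (ℤₚ.*-zeroʳ (δ (src f) x))) (ℤₚ.*-zeroʳ (ε f u)))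
    (sym (∑∖-zero es λ f fs → trans (cong (ε f u *ᶻ_) (ℤₚ.*-zeroʳ (δ (tgt f) (src u)))) (ℤₚ.*-zeroʳ (ε f u)))))
backwardₖ (suc k) x t u es = cong (δ (src u) x *ᶻ trailsₖ (suc k) (tgt u) t es +ᶻ_) (begin
  ∑∖ es (λ r rs → ε r u *ᶻ (δ (src r) x *ᶻ trailsₖ (suc k) (tgt r) t (u ∷ rs)))
    ≡⟨ ∑∖-cong es (λ r rs → trans (cong (λ z → ε r u *ᶻ (δ (src r) x *ᶻ z)) (backwardₖ k (tgt r) t u rs))
         (trans (lem₁ (ε r u) (δ (src r) x) _ _)
           -- In the first summand `u` comes right after the first edge `r`, so `r` itself is the
           -- edge glued to it.
           (cong₂ _+ᶻ_ (lem₄ (ε r u) (δ (src r) x) (src u) (tgt r) _) (sym (∑∖-* (ε r u *ᶻ δ (src r) x) rs _))))) ⟩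
  ∑∖ es (λ r rs → ε r u *ᶻ (δ (tgt r) (src u) *ᶻ (δ (src r) x *ᶻ trailsₖ k (tgt u) t rs))
                  +ᶻ ∑∖ rs (λ f fs → (ε r u *ᶻ δ (src r) x) *ᶻ (ε f u *ᶻ (δ (tgt f) (src u) *ᶻ trailsₖ k (tgt r) t (f · u ∷ fs)))))
    ≡⟨ trans (∑∖-+ es _ _) (trans (cong (∑∖ es (λ r rs → ε r u *ᶻ (δ (tgt r) (src u) *ᶻ (δ (src r) x *ᶻ trailsₖ k (tgt u) t rs))) +ᶻ_) (∑∖-swap es _)) (sym (∑∖-+ es _ _))) ⟩
  ∑∖ es (λ f fs → ε f u *ᶻ (δ (tgt f) (src u) *ᶻ (δ (src f) x *ᶻ trailsₖ k (tgt u) t fs))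
                  +ᶻ ∑∖ fs (λ r rs → ε r f *ᶻ ((ε r u *ᶻ δ (src r) x) *ᶻ (ε f u *ᶻ (δ (tgt f) (src u) *ᶻ trailsₖ k (tgt r) t (f · u ∷ rs))))))
    ≡⟨ ∑∖-cong es (λ f fs → trans
         (cong (ε f u *ᶻ (δ (tgt f) (src u) *ᶻ (δ (src f) x *ᶻ trailsₖ k (tgt u) t fs)) +ᶻ_)
           (trans (∑∖-cong fs λ r rs → trans (lem₂ (ε r f) (ε r u) (δ (src r) x) (ε f u) (δ (tgt f) (src u)) _)
                (cong (λ z → (ε f u *ᶻ δ (tgt f) (src u)) *ᶻ (z *ᶻ (δ (src r) x *ᶻ trailsₖ k (tgt r) t (f · u ∷ rs)))) (sym (ε-· r f u))))
             (∑∖-* (ε f u *ᶻ δ (tgt f) (src u)) fs _)))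
         (lem₃ (ε f u) (δ (tgt f) (src u)) _ _)) ⟩
  _ ∎)
  where
  lem₁ : ∀ a b p q → a *ᶻ (b *ᶻ (p +ᶻ q)) ≡ a *ᶻ (b *ᶻ p) +ᶻ (a *ᶻ b) *ᶻ q
  lem₁ = solve-∀
  lem₂ : ∀ a b c d e p → a *ᶻ ((b *ᶻ c) *ᶻ (d *ᶻ (e *ᶻ p))) ≡ (d *ᶻ e) *ᶻ ((a *ᶻ b) *ᶻ (c *ᶻ p))
  lem₂ = solve-∀
  lem₃ : ∀ a b p q → a *ᶻ (b *ᶻ p) +ᶻ (a *ᶻ b) *ᶻ q ≡ a *ᶻ (b *ᶻ (p +ᶻ q))
  lem₃ = solve-∀
  lem₄ : ∀ a b s t p → a *ᶻ (b *ᶻ (δ s t *ᶻ p)) ≡ a *ᶻ (δ t s *ᶻ (b *ᶻ p))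
  lem₄ a b s t p = cong (a *ᶻ_) (trans (*-exchange b (δ s t) p) (cong (_*ᶻ (b *ᶻ p)) (δ-sym s t)))

-- Rearrangements and their signs

infix 4 _↝[_]_

data _↝[_]_ : List Edge → ℤ → List Edge → Set where
  done  : ∀ {es} → es ↝[ 1ℤ ] es
  skip  : ∀ {es s fs} e → es ↝[ s ] fs → e ∷ es ↝[ s ] e ∷ fs
  swap  : ∀ e f {es} → e ∷ f ∷ es ↝[ ε e f ] f ∷ e ∷ es
  _then_ : ∀ {es s fs t gs} → es ↝[ s ] fs → fs ↝[ t ] gs → es ↝[ s *ᶻ t ] gs

Alternating : (List Edge → ℤ) → Set
Alternating ψ = ∀ {es s fs} → es ↝[ s ] fs → ψ es ≡ s *ᶻ ψ fs

-- When `e` and `f` are exchanged, the terms removing `e` and `f` trade places; in every other term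
-- the exchange happens in the remaining list, where `φ` is alternating.
∑∖-↝ : ∀ {es s fs φ} → (∀ f → Alternating (φ f)) → es ↝[ s ] fs → ∑∖ es φ ≡ s *ᶻ ∑∖ fs φ
∑∖-↝ alt done = sym (ℤₚ.*-identityˡ _)
∑∖-↝ {s = s} {φ = φ} alt (skip {es} {fs = fs} e r) = trans
  (cong₂ _+ᶻ_ (alt e r) (∑∖-↝ (λ f {_} {s′} r′ → trans (cong (ε f e *ᶻ_) (alt f (skip e r′))) (*-exchange (ε f e) s′ _)) r))
  (sym (ℤₚ.*-distribˡ-+ s _ _))
∑∖-↝ {φ = φ} alt (swap e f {es}) = begin
  φ e (f ∷ es) +ᶻ (ε f e *ᶻ φ f (e ∷ es) +ᶻ ∑∖ es (λ g gs → ε g f *ᶻ (ε g e *ᶻ φ g (e ∷ f ∷ gs))))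
    ≡⟨ cong (λ z → φ e (f ∷ es) +ᶻ (ε f e *ᶻ φ f (e ∷ es) +ᶻ z))
         (trans (∑∖-cong es λ g gs → trans (cong (λ z → ε g f *ᶻ (ε g e *ᶻ z)) (alt g (swap e f)))
                   (lem (ε g f) (ε g e) (ε e f) _))
                (∑∖-* (ε e f) es _)) ⟩
  φ e (f ∷ es) +ᶻ (ε f e *ᶻ φ f (e ∷ es) +ᶻ ε e f *ᶻ Z)
    ≡⟨ cong₂ (λ a b → a +ᶻ (b *ᶻ φ f (e ∷ es) +ᶻ ε e f *ᶻ Z))
         (trans (sym (ℤₚ.*-identityˡ _)) (cong (_*ᶻ φ e (f ∷ es)) (sym (ε² e f)))) (ε-sym f e) ⟩
  (ε e f *ᶻ ε e f) *ᶻ φ e (f ∷ es) +ᶻ (ε e f *ᶻ φ f (e ∷ es) +ᶻ ε e f *ᶻ Z)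
    ≡⟨ lem′ (ε e f) (φ e (f ∷ es)) (φ f (e ∷ es)) Z ⟩
  ε e f *ᶻ (φ f (e ∷ es) +ᶻ (ε e f *ᶻ φ e (f ∷ es) +ᶻ Z)) ∎
  where
  Z = ∑∖ es (λ g gs → ε g e *ᶻ (ε g f *ᶻ φ g (f ∷ e ∷ gs)))
  lem : ∀ a b c p → a *ᶻ (b *ᶻ (c *ᶻ p)) ≡ c *ᶻ (b *ᶻ (a *ᶻ p))
  lem = solve-∀
  lem′ : ∀ a p q r → (a *ᶻ a) *ᶻ p +ᶻ (a *ᶻ q +ᶻ a *ᶻ r) ≡ a *ᶻ (q +ᶻ (a *ᶻ p +ᶻ r))
  lem′ = solve-∀
∑∖-↝ alt (_then_ {s = s} {t = t} r r′) = trans (∑∖-↝ alt r) (trans (cong (s *ᶻ_) (∑∖-↝ alt r′)) (sym (ℤₚ.*-assoc s t _)))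

trailsₖ-↝ : ∀ k x t → Alternating (trailsₖ k x t)
trailsₖ-↝ zero x t done       = sym (ℤₚ.*-identityˡ _)
trailsₖ-↝ zero x t (skip {s = s} e r) = sym (ℤₚ.*-zeroʳ s)
trailsₖ-↝ zero x t (swap e f) = sym (ℤₚ.*-zeroʳ (ε e f))
trailsₖ-↝ zero x t (_then_ {s = s} {t = s′} r r′) =
  trans (trailsₖ-↝ zero x t r) (trans (cong (s *ᶻ_) (trailsₖ-↝ zero x t r′)) (sym (ℤₚ.*-assoc s s′ _)))
trailsₖ-↝ (suc k) x t r = ∑∖-↝
  (λ f {_} {s} r′ → trans (cong (δ (src f) x *ᶻ_) (trailsₖ-↝ k (tgt f) t r′)) (*-exchange (δ (src f) x) s _)) r

∑∖-cong-length : ∀ es {φ ψ} → (∀ f fs → suc (length fs) ≡ length es → φ f fs ≡ ψ f fs) → ∑∖ es φ ≡ ∑∖ es ψ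
∑∖-cong-length []       eq = refl
∑∖-cong-length (e ∷ es) eq = cong₂ _+ᶻ_ (eq e es refl)
  (∑∖-cong-length es λ f fs l → cong (ε f e *ᶻ_) (eq f (e ∷ fs) (cong suc l)))

length-↝ : ∀ {es s fs} → es ↝[ s ] fs → length es ≡ length fs
length-↝ done       = refl
length-↝ (skip e r) = cong suc (length-↝ r)
length-↝ (swap e f) = refl
length-↝ (r then r′) = trans (length-↝ r) (length-↝ r′)

opaque

  -- The length serves as recursion argument, since the lists under `∑∖` are not structurally
  -- smaller. Opacity keeps the counts atomic, so that expanding one gluing step on a concrete list
  -- does not unfold into all orderings.
  trails : ℕ → ℕ → List Edge → ℤ
  trails x t es = trailsₖ (length es) x t es

  forward : ∀ x t u es → trails x t (u ∷ es) ≡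
    δ (tgt u) t *ᶻ (εs u es *ᶻ trails x (src u) es)
    +ᶻ ∑∖ es (λ f fs → δ (src f) (tgt u) *ᶻ trails x t (u · f ∷ fs))
  forward x t u es = trans (forwardₖ (length es) x t u es)
    (cong (δ (tgt u) t *ᶻ (εs u es *ᶻ trails x (src u) es) +ᶻ_)
      (∑∖-cong-length es λ f fs l → cong (λ k → δ (src f) (tgt u) *ᶻ trailsₖ k x t (u · f ∷ fs)) (sym l)))

  backward : ∀ x t u es → trails x t (u ∷ es) ≡
    δ (src u) x *ᶻ trails (tgt u) t es
    +ᶻ ∑∖ es (λ f fs → ε f u *ᶻ (δ (tgt f) (src u) *ᶻ trails x t (f · u ∷ fs)))
  backward x t u es = trans (backwardₖ (length es) x t u es)
    (cong (δ (src u) x *ᶻ trails (tgt u) t es +ᶻ_)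
      (∑∖-cong-length es λ f fs l → cong (λ k → ε f u *ᶻ (δ (tgt f) (src u) *ᶻ trailsₖ k x t (f · u ∷ fs))) (sym l)))

  trails-↝ : ∀ x t → Alternating (trails x t)
  trails-↝ x t {es} {s} {fs} r =
    trans (trailsₖ-↝ (length es) x t r) (cong (λ k → s *ᶻ trailsₖ k x t fs) (length-↝ r))

↝-resp : ∀ {es s t fs} → s ≡ t → es ↝[ s ] fs → es ↝[ t ] fs
↝-resp refl r = r

↝-front : ∀ f xs {ys} → xs ++ f ∷ ys ↝[ εs f xs ] f ∷ xs ++ ys
↝-front f []       = done
↝-front f (x ∷ xs) = ↝-resp (trans (ℤₚ.*-comm (εs f xs) (ε x f)) (cong (_*ᶻ εs f xs) (ε-sym x f)))
  (skip x (↝-front f xs) then swap x f)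

↝-skips : ∀ xs {es s fs} → es ↝[ s ] fs → xs ++ es ↝[ s ] xs ++ fs
↝-skips []       r = r
↝-skips (x ∷ xs) r = skip x (↝-skips xs r)

↝-back : ∀ f xs {ys} → f ∷ xs ++ ys ↝[ εs f xs ] xs ++ f ∷ ys
↝-back f []       = done
↝-back f (x ∷ xs) = swap f x then skip x (↝-back f xs)

-- By bilinearity and nondegeneracy of the form this says that the total grade is 0; such a list
-- passes other edges without a sign.
Neutral : List Edge → Set
Neutral xs = ∀ f → εs f xs ≡ 1ℤ

↝-neutral : ∀ xs ys {zs} → Neutral ys → xs ++ ys ++ zs ↝[ 1ℤ ] ys ++ xs ++ zs
↝-neutral []       ys n = done
↝-neutral (x ∷ xs) ys n = skip x (↝-neutral xs ys n) then ↝-resp (n x) (↝-back x ys)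

x≡-x⇒x≡0 : ∀ x → x ≡ -1ℤ *ᶻ x → x ≡ 0ℤ
x≡-x⇒x≡0 (+ zero) eq = refl
x≡-x⇒x≡0 (+ suc n) ()
x≡-x⇒x≡0 (ℤ.negsuc n) ()

-- Once the two copies of `f` are adjacent, exchanging them reverses the sign but does not change
-- the list.
parallel : ∀ x t f {es} → ε f f ≡ -1ℤ → f ∈ˡ es → trails x t (f ∷ es) ≡ 0ℤ
parallel x t f odd f∈ with ∈-∃++ f∈
... | xs , ys , refl = trans (trails-↝ x t (skip f (↝-front f xs)))
  (trans (cong (εs f xs *ᶻ_) (x≡-x⇒x≡0 _ (trans (trails-↝ x t (swap f f)) (cong (_*ᶻ trails x t (f ∷ f ∷ xs ++ ys)) odd))))
    (ℤₚ.*-zeroʳ (εs f xs)))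

-- Out-degrees and neutral loops

∑ᴱ : (Edge → ℤ) → List Edge → ℤ
∑ᴱ g []       = 0ℤ
∑ᴱ g (e ∷ es) = g e +ᶻ ∑ᴱ g es

-- The sign built into `∑∖` is that of moving `f` to the front. Putting `f` back there undoes it, so
-- each term is a multiple of the same `ψ es`.
∑∖-front : ∀ {ψ} → Alternating ψ → ∀ g es → ∑∖ es (λ f fs → g f *ᶻ ψ (f ∷ fs)) ≡ ∑ᴱ g es *ᶻ ψ es
∑∖-front alt g []       = refl
∑∖-front {ψ} alt g (e ∷ es) = begin
  g e *ᶻ ψ (e ∷ es) +ᶻ ∑∖ es (λ f fs → ε f e *ᶻ (g f *ᶻ ψ (f ∷ e ∷ fs)))
    ≡⟨ cong (g e *ᶻ ψ (e ∷ es) +ᶻ_) (∑∖-cong es λ f fs → trans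
         (cong (λ z → ε f e *ᶻ (g f *ᶻ z)) (alt (swap f e)))
         (trans (lem (ε f e) (g f) (ψ (e ∷ f ∷ fs))) (trans (cong (_*ᶻ (g f *ᶻ ψ (e ∷ f ∷ fs))) (ε² f e)) (ℤₚ.*-identityˡ _)))) ⟩
  g e *ᶻ ψ (e ∷ es) +ᶻ ∑∖ es (λ f fs → g f *ᶻ ψ (e ∷ f ∷ fs))
    ≡⟨ cong (g e *ᶻ ψ (e ∷ es) +ᶻ_) (∑∖-front (λ r → alt (skip e r)) g es) ⟩
  g e *ᶻ ψ (e ∷ es) +ᶻ ∑ᴱ g es *ᶻ ψ (e ∷ es)
    ≡⟨ ℤₚ.*-distribʳ-+ (ψ (e ∷ es)) (g e) (∑ᴱ g es) ⟨
  (g e +ᶻ ∑ᴱ g es) *ᶻ ψ (e ∷ es) ∎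
  where
  lem : ∀ a b c → a *ᶻ (b *ᶻ (a *ᶻ c)) ≡ (a *ᶻ a) *ᶻ (b *ᶻ c)
  lem = solve-∀

outdeg : ℕ → List Edge → ℤ
outdeg v = ∑ᴱ (λ f → δ (src f) v)

δ-subst : ∀ a b (F : ℕ → ℤ) → δ a b *ᶻ F a ≡ δ a b *ᶻ F b
δ-subst zero    zero    F = refl
δ-subst zero    (suc b) F = refl
δ-subst (suc a) zero    F = refl
δ-subst (suc a) (suc b) F = δ-subst a b (λ x → F (suc x))

εs-neutral : ∀ v w es → εs (edge v w false false) es ≡ 1ℤ
εs-neutral v w []       = refl
εs-neutral v w (e ∷ es) = trans (ℤₚ.*-identityˡ _) (εs-neutral v w es)

-- A neutral loop can be inserted at any visit of its vertex.
neutral-loop : ∀ x t v es → trails x t (edge v v false false ∷ es) ≡ (δ v t +ᶻ outdeg v es) *ᶻ trails x t es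
neutral-loop x t v es = begin
  trails x t (edge v v false false ∷ es)
    ≡⟨ forward x t (edge v v false false) es ⟩
  δ v t *ᶻ (εs (edge v v false false) es *ᶻ trails x v es)
  +ᶻ ∑∖ es (λ f fs → δ (src f) v *ᶻ trails x t (edge v (tgt f) (β f) (ω f) ∷ fs))
    ≡⟨ cong₂ _+ᶻ_
         (trans (cong (λ z → δ v t *ᶻ (z *ᶻ trails x v es)) (εs-neutral v v es))
           (trans (cong (δ v t *ᶻ_) (ℤₚ.*-identityˡ _)) (δ-subst v t (λ y → trails x y es))))
         -- Gluing the loop to an edge `f` that starts at `v` gives back `f` itself.
         (trans (∑∖-cong es λ f fs → sym (δ-subst (src f) v (λ y → trails x t (edge y (tgt f) (β f) (ω f) ∷ fs))))
           (∑∖-front (trails-↝ x t) _ es)) ⟩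
  δ v t *ᶻ trails x t es +ᶻ outdeg v es *ᶻ trails x t es
    ≡⟨ ℤₚ.*-distribʳ-+ (trails x t es) (δ v t) (outdeg v es) ⟨
  _ ∎

∑∖-++ : ∀ xs {ys} φ → ∑∖ (xs ++ ys) φ ≡ ∑∖ xs (λ f fs → φ f (fs ++ ys)) +ᶻ ∑∖ ys (λ f fs → εs f xs *ᶻ φ f (xs ++ fs))
∑∖-++ [] {ys} φ = trans (∑∖-cong ys λ f fs → sym (ℤₚ.*-identityˡ _)) (sym (ℤₚ.+-identityˡ _))
∑∖-++ (x ∷ xs) {ys} φ = trans
  (cong (φ x (xs ++ ys) +ᶻ_) (trans (∑∖-++ xs _)
    (cong (∑∖ xs (λ f fs → ε f x *ᶻ φ f (x ∷ fs ++ ys)) +ᶻ_) (∑∖-cong ys λ f fs → lem (εs f xs) (ε f x) _))))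
  (sym (ℤₚ.+-assoc (φ x (xs ++ ys)) _ _))
  where
  lem : ∀ a b c → a *ᶻ (b *ᶻ c) ≡ (b *ᶻ a) *ᶻ c
  lem = solve-∀

B₁₂ B₂₁ : Edge
B₁₂ = edge 0 1 true false
B₂₁ = edge 1 0 true false

bs : ℕ → ℕ → List Edge
bs a b = replicate a B₁₂ ++ replicate b B₂₁

-- The entries with pred are multiplied by 0 when there is no such edge.
∑∖-bs : ∀ a b φ → ∑∖ (bs a b) φ ≡ + a *ᶻ φ B₁₂ (bs (pred a) b) +ᶻ + b *ᶻ φ B₂₁ (bs a (pred b))
∑∖-bs zero zero φ = refl
∑∖-bs zero (suc b) φ = begin
  φ B₂₁ (bs 0 b) +ᶻ ∑∖ (bs 0 b) (λ f fs → ε f B₂₁ *ᶻ φ f (B₂₁ ∷ fs))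
    ≡⟨ cong (φ B₂₁ (bs 0 b) +ᶻ_) (∑∖-bs zero b _) ⟩
  φ B₂₁ (bs 0 b) +ᶻ (0ℤ +ᶻ + b *ᶻ (1ℤ *ᶻ φ B₂₁ (B₂₁ ∷ bs 0 (pred b))))
    ≡⟨ cong (φ B₂₁ (bs 0 b) +ᶻ_) (lem b) ⟩
  φ B₂₁ (bs 0 b) +ᶻ + b *ᶻ φ B₂₁ (bs 0 b)
    ≡⟨ lem′ (+ b) (φ B₂₁ (bs 0 b)) ⟩
  0ℤ +ᶻ (1ℤ +ᶻ + b) *ᶻ φ B₂₁ (bs 0 b) ∎
  where
  lem : ∀ b → 0ℤ +ᶻ + b *ᶻ (1ℤ *ᶻ φ B₂₁ (B₂₁ ∷ bs 0 (pred b))) ≡ + b *ᶻ φ B₂₁ (bs 0 b)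
  lem zero    = refl
  lem (suc b) = trans (ℤₚ.+-identityˡ _) (cong (+ suc b *ᶻ_) (ℤₚ.*-identityˡ _))
  lem′ : ∀ b p → p +ᶻ b *ᶻ p ≡ 0ℤ +ᶻ (1ℤ +ᶻ b) *ᶻ p
  lem′ = solve-∀
∑∖-bs (suc a) b φ = begin
  φ B₁₂ (bs a b) +ᶻ ∑∖ (bs a b) (λ f fs → ε f B₁₂ *ᶻ φ f (B₁₂ ∷ fs))
    ≡⟨ cong (φ B₁₂ (bs a b) +ᶻ_) (∑∖-bs a b _) ⟩
  φ B₁₂ (bs a b) +ᶻ (+ a *ᶻ (1ℤ *ᶻ φ B₁₂ (B₁₂ ∷ bs (pred a) b)) +ᶻ + b *ᶻ (1ℤ *ᶻ φ B₂₁ (bs (suc a) (pred b))))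
    ≡⟨ cong (λ z → φ B₁₂ (bs a b) +ᶻ (z +ᶻ + b *ᶻ (1ℤ *ᶻ φ B₂₁ (bs (suc a) (pred b))))) (lem a) ⟩
  φ B₁₂ (bs a b) +ᶻ (+ a *ᶻ φ B₁₂ (bs a b) +ᶻ + b *ᶻ (1ℤ *ᶻ φ B₂₁ (bs (suc a) (pred b))))
    ≡⟨ lem′ (+ a) (+ b) (φ B₁₂ (bs a b)) (φ B₂₁ (bs (suc a) (pred b))) ⟩
  _ ∎
  where
  lem : ∀ a → + a *ᶻ (1ℤ *ᶻ φ B₁₂ (B₁₂ ∷ bs (pred a) b)) ≡ + a *ᶻ φ B₁₂ (bs a b)
  lem zero    = refl
  lem (suc a) = cong (+ suc a *ᶻ_) (ℤₚ.*-identityˡ _)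
  lem′ : ∀ a b p q → p +ᶻ (a *ᶻ p +ᶻ b *ᶻ (1ℤ *ᶻ q)) ≡ (1ℤ +ᶻ a) *ᶻ p +ᶻ b *ᶻ q
  lem′ = solve-∀

-- Trails on the vertices 0 and 1

-- For a concrete `sp` all sums, signs and `δ` factors over it compute, so each expansion below
-- holds by definition and leaves only ring identities.
forward-bs : ∀ x t u sp a b → trails x t (u ∷ sp ++ bs a b) ≡
  δ (tgt u) t *ᶻ (εs u (sp ++ bs a b) *ᶻ trails x (src u) (sp ++ bs a b))
  +ᶻ (∑∖ sp (λ f fs → δ (src f) (tgt u) *ᶻ trails x t (u · f ∷ fs ++ bs a b))
  +ᶻ (+ a *ᶻ (εs B₁₂ sp *ᶻ (δ 0 (tgt u) *ᶻ trails x t (u · B₁₂ ∷ sp ++ bs (pred a) b)))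
  +ᶻ + b *ᶻ (εs B₂₁ sp *ᶻ (δ 1 (tgt u) *ᶻ trails x t (u · B₂₁ ∷ sp ++ bs a (pred b))))))
forward-bs x t u sp a b = trans (forward x t u (sp ++ bs a b))
  (cong (δ (tgt u) t *ᶻ (εs u (sp ++ bs a b) *ᶻ trails x (src u) (sp ++ bs a b)) +ᶻ_)
    (trans (∑∖-++ sp _) (cong (∑∖ sp (λ f fs → δ (src f) (tgt u) *ᶻ trails x t (u · f ∷ fs ++ bs a b)) +ᶻ_) (∑∖-bs a b _))))

backward-bs : ∀ x t u sp a b → trails x t (u ∷ sp ++ bs a b) ≡
  δ (src u) x *ᶻ trails (tgt u) t (sp ++ bs a b)
  +ᶻ (∑∖ sp (λ f fs → ε f u *ᶻ (δ (tgt f) (src u) *ᶻ trails x t (f · u ∷ fs ++ bs a b)))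
  +ᶻ (+ a *ᶻ (εs B₁₂ sp *ᶻ (ε B₁₂ u *ᶻ (δ 1 (src u) *ᶻ trails x t (B₁₂ · u ∷ sp ++ bs (pred a) b))))
  +ᶻ + b *ᶻ (εs B₂₁ sp *ᶻ (ε B₂₁ u *ᶻ (δ 0 (src u) *ᶻ trails x t (B₂₁ · u ∷ sp ++ bs a (pred b)))))))
backward-bs x t u sp a b = trans (backward x t u (sp ++ bs a b))
  (cong (δ (src u) x *ᶻ trails (tgt u) t (sp ++ bs a b) +ᶻ_)
    (trans (∑∖-++ sp _) (cong (∑∖ sp (λ f fs → ε f u *ᶻ (δ (tgt f) (src u) *ᶻ trails x t (f · u ∷ fs ++ bs a b))) +ᶻ_) (∑∖-bs a b _))))

εs-++ : ∀ u xs ys → εs u (xs ++ ys) ≡ εs u xs *ᶻ εs u ys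
εs-++ u []       ys = sym (ℤₚ.*-identityˡ _)
εs-++ u (x ∷ xs) ys = trans (cong (ε u x *ᶻ_) (εs-++ u xs ys)) (sym (ℤₚ.*-assoc (ε u x) _ _))

εs² : ∀ u es → εs u es *ᶻ εs u es ≡ 1ℤ
εs² u []       = refl
εs² u (e ∷ es) = trans (lem (ε u e) (εs u es)) (cong₂ _*ᶻ_ (ε² u e) (εs² u es))
  where
  lem : ∀ a b → (a *ᶻ b) *ᶻ (a *ᶻ b) ≡ (a *ᶻ a) *ᶻ (b *ᶻ b)
  lem = solve-∀

εs-B : ∀ es → εs B₂₁ es ≡ εs B₁₂ es
εs-B []       = refl
εs-B (e ∷ es) = cong (ε B₂₁ e *ᶻ_) (εs-B es)

-- Guarantees that only `B₂₁` leaves vertex 1, so that nothing else can follow a `B₁₂`.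
FromZero : List Edge → Set
FromZero = All (λ e → src e ≡ 0)

∑ᴱ-++ : ∀ g xs ys → ∑ᴱ g (xs ++ ys) ≡ ∑ᴱ g xs +ᶻ ∑ᴱ g ys
∑ᴱ-++ g []       ys = sym (ℤₚ.+-identityˡ _)
∑ᴱ-++ g (x ∷ xs) ys = trans (cong (g x +ᶻ_) (∑ᴱ-++ g xs ys)) (sym (ℤₚ.+-assoc (g x) _ _))

outdeg-bs : ∀ a b → outdeg 0 (bs a b) ≡ + a
outdeg-bs zero    zero    = refl
outdeg-bs zero    (suc b) = trans (ℤₚ.+-identityˡ _) (outdeg-bs zero b)
outdeg-bs (suc a) b       = cong (1ℤ +ᶻ_) (outdeg-bs a b)

outdeg-FromZero : ∀ {sp} → FromZero sp → outdeg 0 sp ≡ + length sp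
outdeg-FromZero []          = refl
outdeg-FromZero (refl ∷ ps) = cong (1ℤ +ᶻ_) (outdeg-FromZero ps)

outdeg-loops : ∀ {sp} a b → FromZero sp → outdeg 0 (sp ++ bs a b) ≡ + (length sp + a)
outdeg-loops {sp} a b ps = trans (∑ᴱ-++ _ sp (bs a b)) (cong₂ _+ᶻ_ (outdeg-FromZero ps) (outdeg-bs a b))

-- Joining a B₁₂ to the next edge either closes up the trail, or produces a
-- neutral loop.
join-B : ∀ t {sp} a b → FromZero sp → trails 0 t (sp ++ bs (suc a) b) ≡
  δ 1 t *ᶻ (εs B₁₂ sp *ᶻ (εs B₁₂ (sp ++ bs a b) *ᶻ trails 0 0 (sp ++ bs a b)))
  +ᶻ + b *ᶻ ((δ 0 t +ᶻ + (length sp + a)) *ᶻ trails 0 t (sp ++ bs a (pred b)))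
join-B t {sp} a b ps = begin
  trails 0 t (sp ++ B₁₂ ∷ bs a b)
    ≡⟨ trails-↝ 0 t (↝-front B₁₂ sp) ⟩
  s *ᶻ trails 0 t (B₁₂ ∷ sp ++ bs a b)
    ≡⟨ cong (s *ᶻ_) (forward-bs 0 t B₁₂ sp a b) ⟩
  s *ᶻ (δ 1 t *ᶻ Z +ᶻ (∑∖ sp _ +ᶻ (+ a *ᶻ (s *ᶻ 0ℤ) +ᶻ + b *ᶻ (εs B₂₁ sp *ᶻ (1ℤ *ᶻ trails 0 t (loop ∷ sp ++ bs a (pred b)))))))
    ≡⟨ cong₂ (λ y z → s *ᶻ (δ 1 t *ᶻ Z +ᶻ (y +ᶻ (+ a *ᶻ (s *ᶻ 0ℤ) +ᶻ + b *ᶻ z))))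
         (∑∖-All-zero ps λ { f fs refl → refl })
         (cong₂ (λ y z → y *ᶻ (1ℤ *ᶻ z)) (εs-B sp)
           (trans (neutral-loop 0 t 0 (sp ++ bs a (pred b))) (cong (λ n → (δ 0 t +ᶻ n) *ᶻ V) (outdeg-loops a (pred b) ps)))) ⟩
  s *ᶻ (δ 1 t *ᶻ Z +ᶻ (0ℤ +ᶻ (+ a *ᶻ (s *ᶻ 0ℤ) +ᶻ + b *ᶻ (s *ᶻ (1ℤ *ᶻ (c *ᶻ V))))))
    ≡⟨ lem s (δ 1 t) Z (+ a) (+ b) (c *ᶻ V) ⟩
  δ 1 t *ᶻ (s *ᶻ Z) +ᶻ + b *ᶻ ((s *ᶻ s) *ᶻ (c *ᶻ V))
    ≡⟨ cong (λ z → δ 1 t *ᶻ (s *ᶻ Z) +ᶻ + b *ᶻ z) (trans (cong (_*ᶻ (c *ᶻ V)) (εs² B₁₂ sp)) (ℤₚ.*-identityˡ _)) ⟩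
  _ ∎
  where
  loop = edge 0 0 false false
  s = εs B₁₂ sp
  Z = εs B₁₂ (sp ++ bs a b) *ᶻ trails 0 0 (sp ++ bs a b)
  V = trails 0 t (sp ++ bs a (pred b))
  c = δ 0 t +ᶻ + (length sp + a)
  lem : ∀ s d z a b v → s *ᶻ (d *ᶻ z +ᶻ (0ℤ +ᶻ (a *ᶻ (s *ᶻ 0ℤ) +ᶻ b *ᶻ (s *ᶻ (1ℤ *ᶻ v))))) ≡ d *ᶻ (s *ᶻ z) +ᶻ b *ᶻ ((s *ᶻ s) *ᶻ v)
  lem = solve-∀

fac : ℕ → ℤ
fac n = + (n !)

fac-suc : ∀ n → fac (suc n) ≡ + suc n *ᶻ fac n
fac-suc n = ℤₚ.pos-* (suc n) (n !)

-- With a pairs present, a `B₁₂` can be joined to any of a edges `B₂₁`, and the resulting loop can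
-- be inserted at any of length sp + a visits of vertex 0. The product of these choices is a!
-- (length sp + a)! / (length sp)!, stated without division.
closed-loops : ∀ {sp} a → FromZero sp →
  fac (length sp) *ᶻ trails 0 0 (sp ++ bs a a) ≡ fac a *ᶻ (fac (length sp + a) *ᶻ trails 0 0 (sp ++ []))
closed-loops {sp} zero ps = trans (cong (λ n → fac n *ᶻ trails 0 0 (sp ++ [])) (sym (ℕₚ.+-identityʳ (length sp)))) (sym (ℤₚ.*-identityˡ _))
closed-loops {sp} (suc a) ps = begin
  fac n *ᶻ trails 0 0 (sp ++ bs (suc a) (suc a))
    ≡⟨ cong (fac n *ᶻ_) (join-B 0 a (suc a) ps) ⟩
  fac n *ᶻ (0ℤ +ᶻ + suc a *ᶻ (+ suc (n + a) *ᶻ trails 0 0 (sp ++ bs a a)))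
    ≡⟨ lem (fac n) (+ suc a) (+ suc (n + a)) _ ⟩
  (+ suc a *ᶻ + suc (n + a)) *ᶻ (fac n *ᶻ trails 0 0 (sp ++ bs a a))
    ≡⟨ cong ((+ suc a *ᶻ + suc (n + a)) *ᶻ_) (closed-loops a ps) ⟩
  (+ suc a *ᶻ + suc (n + a)) *ᶻ (fac a *ᶻ (fac (n + a) *ᶻ trails 0 0 (sp ++ [])))
    ≡⟨ lem′ (+ suc a) (+ suc (n + a)) (fac a) (fac (n + a)) _ ⟩
  (+ suc a *ᶻ fac a) *ᶻ ((+ suc (n + a) *ᶻ fac (n + a)) *ᶻ trails 0 0 (sp ++ []))
    ≡⟨ cong₂ (λ x y → x *ᶻ (y *ᶻ trails 0 0 (sp ++ []))) (sym (fac-suc a))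
         (trans (sym (fac-suc (n + a))) (cong fac (sym (ℕₚ.+-suc n a)))) ⟩
  fac (suc a) *ᶻ (fac (n + suc a) *ᶻ trails 0 0 (sp ++ [])) ∎
  where
  n = length sp
  lem : ∀ f a b v → f *ᶻ (0ℤ +ᶻ a *ᶻ (b *ᶻ v)) ≡ (a *ᶻ b) *ᶻ (f *ᶻ v)
  lem = solve-∀
  lem′ : ∀ a b c d v → (a *ᶻ b) *ᶻ (c *ᶻ (d *ᶻ v)) ≡ (a *ᶻ c) *ᶻ ((b *ᶻ d) *ᶻ v)
  lem′ = solve-∀

module _ {sp} (ps : FromZero sp) (vanish : trails 0 0 (sp ++ []) ≡ 0ℤ) where

  closed-loops-zero : ∀ a → trails 0 0 (sp ++ bs a a) ≡ 0ℤ
  closed-loops-zero zero    = vanish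
  closed-loops-zero (suc a) = trans (join-B 0 a (suc a) ps)
    (trans (cong (λ z → 0ℤ +ᶻ + suc a *ᶻ (+ suc (length sp + a) *ᶻ z)) (closed-loops-zero a))
      (lem (+ suc a) (+ suc (length sp + a))))
    where
    lem : ∀ a b → 0ℤ +ᶻ a *ᶻ (b *ᶻ 0ℤ) ≡ 0ℤ
    lem = solve-∀

  -- A `B₁₂` either ends the trail, leaving a closed count that vanishes, or is joined to a `B₂₁`,
  -- leaving an open count with one pair fewer.
  open-loops-zero : ∀ a → trails 0 1 (sp ++ bs (suc a) a) ≡ 0ℤ
  open-loops-zero a = trans (join-B 1 a a ps)
    (trans (cong₂ (λ y z → 1ℤ *ᶻ (s *ᶻ (s′ *ᶻ y)) +ᶻ z) (closed-loops-zero a) (rest a)) (lem s s′))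
    where
    s  = εs B₁₂ sp
    s′ = εs B₁₂ (sp ++ bs a a)
    rest : ∀ a → + a *ᶻ ((0ℤ +ᶻ + (length sp + a)) *ᶻ trails 0 1 (sp ++ bs a (pred a))) ≡ 0ℤ
    rest zero    = refl
    rest (suc a) = trans (cong (λ z → + suc a *ᶻ ((0ℤ +ᶻ + (length sp + suc a)) *ᶻ z)) (open-loops-zero a))
      (lem′ (+ suc a) (0ℤ +ᶻ + (length sp + suc a)))
      where
      lem′ : ∀ a b → a *ᶻ (b *ᶻ 0ℤ) ≡ 0ℤ
      lem′ = solve-∀
    lem : ∀ s s′ → 1ℤ *ᶻ (s *ᶻ (s′ *ᶻ 0ℤ)) +ᶻ 0ℤ ≡ 0ℤ
    lem = solve-∀

odd : ℕ → ℕ → Edge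
odd i j = edge i j false true

evenLoop : ℕ → Edge
evenLoop v = edge v v false false

-- Signs see only grades, so `B₁₂` and `B₂₁` cancel in pairs and one `B₂₁` is left.
εs-bs-suc : ∀ u a → εs u (bs a (suc a)) ≡ ε u B₂₁
εs-bs-suc u a = trans (εs-++ u (replicate a B₁₂) (replicate (suc a) B₂₁)) (trans (cong (εs u (replicate a B₁₂) *ᶻ_) (cong (ε u B₂₁ *ᶻ_) (sym (same a))))
  (trans (lem (εs u (replicate a B₁₂)) (ε u B₂₁)) (trans (cong (ε u B₂₁ *ᶻ_) (εs² u (replicate a B₁₂))) (ℤₚ.*-identityʳ _))))
  where
  same : ∀ a → εs u (replicate a B₁₂) ≡ εs u (replicate a B₂₁)
  same zero    = refl
  same (suc a) = cong (ε u B₁₂ *ᶻ_) (same a)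
  lem : ∀ a b → a *ᶻ (b *ᶻ a) ≡ b *ᶻ (a *ᶻ a)
  lem = solve-∀

opaque
  unfolding trails

  -- Every ordering of loops at one vertex is a trail, so these counts depend only on grades: two
  -- anticommuting loops give 0, two commuting loops give 2.
  loops-o : trails 0 0 (odd 0 0 ∷ []) ≡ 1ℤ
  loops-o = refl

  loops-β-o : trails 0 0 (edge 0 0 true false ∷ odd 0 0 ∷ []) ≡ 0ℤ
  loops-β-o = refl

  loops-βo-o : trails 0 0 (edge 0 0 true true ∷ odd 0 0 ∷ []) ≡ + 2
  loops-βo-o = refl

  -- The first loop anticommutes with the other two, which commute: its three positions contribute 1
  -- - 1 + 1, the order of the others a factor 2.
  loops-β-βo-o : trails 0 0 (edge 0 0 true false ∷ edge 0 0 true true ∷ odd 0 0 ∷ []) ≡ + 2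
  loops-β-βo-o = refl

-- If `Y` does not end the trail, it is joined to a `B₂₁`; the resulting loop anticommutes with
-- `odd 0 0`, and these terms vanish.
even₁₂-value : ∀ m → trails 0 1 (edge 0 1 false false ∷ odd 0 0 ∷ bs m m) ≡ fac m *ᶻ fac (suc m)
even₁₂-value m = begin
  trails 0 1 (Y ∷ odd 0 0 ∷ bs m m)
    ≡⟨ forward-bs 0 1 Y (odd 0 0 ∷ []) m m ⟩
  1ℤ *ᶻ (εs Y (odd 0 0 ∷ bs m m) *ᶻ K) +ᶻ (0ℤ +ᶻ (+ m *ᶻ 0ℤ +ᶻ + m *ᶻ (-1ℤ *ᶻ (1ℤ *ᶻ trails 0 1 (edge 0 0 true false ∷ odd 0 0 ∷ bs m (pred m))))))
    ≡⟨ cong₂ (λ y z → 1ℤ *ᶻ (y *ᶻ K) +ᶻ (0ℤ +ᶻ (+ m *ᶻ 0ℤ +ᶻ z))) (εs-neutral 0 1 (odd 0 0 ∷ bs m m)) (vanish m) ⟩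
  1ℤ *ᶻ (1ℤ *ᶻ K) +ᶻ (0ℤ +ᶻ (+ m *ᶻ 0ℤ +ᶻ 0ℤ))
    ≡⟨ lem (+ m) K ⟩
  fac 1 *ᶻ K
    ≡⟨ closed-loops {odd 0 0 ∷ []} m (refl ∷ []) ⟩
  fac m *ᶻ (fac (suc m) *ᶻ trails 0 0 (odd 0 0 ∷ []))
    ≡⟨ cong (fac m *ᶻ_) (trans (cong (fac (suc m) *ᶻ_) loops-o) (ℤₚ.*-identityʳ _)) ⟩
  fac m *ᶻ fac (suc m) ∎
  where
  Y = edge 0 1 false false
  K = trails 0 0 (odd 0 0 ∷ bs m m)
  vanish : ∀ m → + m *ᶻ (-1ℤ *ᶻ (1ℤ *ᶻ trails 0 1 (edge 0 0 true false ∷ odd 0 0 ∷ bs m (pred m)))) ≡ 0ℤ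
  vanish zero    = refl
  vanish (suc a) = trans (cong (λ z → + suc a *ᶻ (-1ℤ *ᶻ (1ℤ *ᶻ z)))
    (open-loops-zero {edge 0 0 true false ∷ odd 0 0 ∷ []} (refl ∷ refl ∷ []) loops-β-o a)) (ℤₚ.*-zeroʳ (+ suc a))
  lem : ∀ m k → 1ℤ *ᶻ (1ℤ *ᶻ k) +ᶻ (0ℤ +ᶻ (m *ᶻ 0ℤ +ᶻ 0ℤ)) ≡ 1ℤ *ᶻ k
  lem = solve-∀

-- Joining `V` to a `B₂₁` would create a second `odd 0 0`, so `V` ends the trail. In the closed
-- trail before it, `odd 0 1` must be followed by one of the a+1 edges `B₂₁`, which leaves two
-- commuting loops.
twisted₁₂-value : ∀ a → trails 0 1 (edge 0 1 true true ∷ odd 0 0 ∷ odd 0 1 ∷ bs a (suc a)) ≡ -1ℤ *ᶻ (fac (suc a) *ᶻ fac (suc (suc a)))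
twisted₁₂-value a = begin
  trails 0 1 (V ∷ odd 0 0 ∷ odd 0 1 ∷ bs a (suc a))
    ≡⟨ forward-bs 0 1 V (odd 0 0 ∷ odd 0 1 ∷ []) a (suc a) ⟩
  1ℤ *ᶻ ((1ℤ *ᶻ (1ℤ *ᶻ εs V (bs a (suc a)))) *ᶻ K) +ᶻ (0ℤ +ᶻ (+ a *ᶻ 0ℤ +ᶻ + suc a *ᶻ (1ℤ *ᶻ (1ℤ *ᶻ trails 0 1 (odd 0 0 ∷ odd 0 0 ∷ odd 0 1 ∷ bs a a)))))
    ≡⟨ cong₂ (λ y z → 1ℤ *ᶻ ((1ℤ *ᶻ (1ℤ *ᶻ y)) *ᶻ K) +ᶻ (0ℤ +ᶻ (+ a *ᶻ 0ℤ +ᶻ + suc a *ᶻ (1ℤ *ᶻ (1ℤ *ᶻ z)))))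
         (εs-bs-suc V a) (parallel 0 1 (odd 0 0) refl (here refl)) ⟩
  1ℤ *ᶻ (-1ℤ *ᶻ K) +ᶻ (0ℤ +ᶻ (+ a *ᶻ 0ℤ +ᶻ + suc a *ᶻ 0ℤ))
    ≡⟨ lem K (+ a) (+ suc a) ⟩
  -1ℤ *ᶻ K
    ≡⟨ cong (-1ℤ *ᶻ_) closed ⟩
  -1ℤ *ᶻ (fac (suc a) *ᶻ fac (suc (suc a))) ∎
  where
  V = edge 0 1 true true
  K = trails 0 0 (odd 0 0 ∷ odd 0 1 ∷ bs a (suc a))
  D = trails 0 0 (edge 0 0 true true ∷ odd 0 0 ∷ bs a a)
  lem : ∀ k a b → 1ℤ *ᶻ (-1ℤ *ᶻ k) +ᶻ (0ℤ +ᶻ (a *ᶻ 0ℤ +ᶻ b *ᶻ 0ℤ)) ≡ -1ℤ *ᶻ k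
  lem = solve-∀
  lem₂ : ∀ a b d → -1ℤ *ᶻ (0ℤ +ᶻ (0ℤ +ᶻ (a *ᶻ 0ℤ +ᶻ b *ᶻ (-1ℤ *ᶻ (1ℤ *ᶻ d))))) ≡ b *ᶻ d
  lem₂ = solve-∀
  lem₃ : ∀ x y → x *ᶻ (y *ᶻ + 2) ≡ + 2 *ᶻ (x *ᶻ y)
  lem₃ = solve-∀
  D-value : D ≡ fac a *ᶻ fac (suc (suc a))
  D-value = ℤₚ.*-cancelˡ-≡ (+ 2) _ _ (trans (closed-loops {edge 0 0 true true ∷ odd 0 0 ∷ []} a (refl ∷ refl ∷ []))
    (trans (cong (λ z → fac a *ᶻ (fac (suc (suc a)) *ᶻ z)) loops-βo-o) (lem₃ (fac a) (fac (suc (suc a))))))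
  closed : K ≡ fac (suc a) *ᶻ fac (suc (suc a))
  closed = begin
    K
      ≡⟨ trans (trails-↝ 0 0 (swap (odd 0 0) (odd 0 1))) (cong (-1ℤ *ᶻ_) (forward-bs 0 0 (odd 0 1) (odd 0 0 ∷ []) a (suc a))) ⟩
    -1ℤ *ᶻ (0ℤ +ᶻ (0ℤ +ᶻ (+ a *ᶻ 0ℤ +ᶻ + suc a *ᶻ (-1ℤ *ᶻ (1ℤ *ᶻ D)))))
      ≡⟨ lem₂ (+ a) (+ suc a) D ⟩
    + suc a *ᶻ D
      ≡⟨ trans (cong (+ suc a *ᶻ_) D-value) (trans (sym (ℤₚ.*-assoc (+ suc a) (fac a) _)) (cong (_*ᶻ fac (suc (suc a))) (sym (fac-suc a)))) ⟩
    fac (suc a) *ᶻ fac (suc (suc a)) ∎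

-- The loop `odd 1 1` is preceded by `odd 0 1` or by one of the m edges `B₁₂`; the two cases
-- contribute 1 and m times m!(m+1)!.
two-vertices : ∀ m → trails 0 1 (odd 1 1 ∷ odd 0 0 ∷ odd 0 1 ∷ bs m m) ≡ fac (suc m) *ᶻ fac (suc m)
two-vertices m = begin
  trails 0 1 (odd 1 1 ∷ odd 0 0 ∷ odd 0 1 ∷ bs m m)
    ≡⟨ backward-bs 0 1 (odd 1 1) (odd 0 0 ∷ odd 0 1 ∷ []) m m ⟩
  0ℤ +ᶻ ((0ℤ +ᶻ (-1ℤ *ᶻ (-1ℤ *ᶻ (1ℤ *ᶻ T₁)) +ᶻ 0ℤ)) +ᶻ (+ m *ᶻ (1ℤ *ᶻ (-1ℤ *ᶻ (1ℤ *ᶻ T₂ m))) +ᶻ + m *ᶻ 0ℤ))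
    ≡⟨ cong₂ (λ y z → 0ℤ +ᶻ ((0ℤ +ᶻ (-1ℤ *ᶻ (-1ℤ *ᶻ (1ℤ *ᶻ y)) +ᶻ 0ℤ)) +ᶻ (z +ᶻ + m *ᶻ 0ℤ))) (even₁₂-value m) (value m) ⟩
  0ℤ +ᶻ ((0ℤ +ᶻ (-1ℤ *ᶻ (-1ℤ *ᶻ (1ℤ *ᶻ (fac m *ᶻ fac (suc m)))) +ᶻ 0ℤ)) +ᶻ (+ m *ᶻ (fac m *ᶻ fac (suc m)) +ᶻ + m *ᶻ 0ℤ))
    ≡⟨ lem (+ m) (fac m) (fac (suc m)) ⟩
  ((1ℤ +ᶻ + m) *ᶻ fac m) *ᶻ fac (suc m)
    ≡⟨ cong (_*ᶻ fac (suc m)) (sym (fac-suc m)) ⟩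
  fac (suc m) *ᶻ fac (suc m) ∎
  where
  T₁ = trails 0 1 (edge 0 1 false false ∷ odd 0 0 ∷ bs m m)
  T₂ : ℕ → ℤ
  T₂ m = trails 0 1 (edge 0 1 true true ∷ odd 0 0 ∷ odd 0 1 ∷ bs (pred m) m)
  lem₁ : ∀ m z → m *ᶻ (1ℤ *ᶻ (-1ℤ *ᶻ (1ℤ *ᶻ (-1ℤ *ᶻ z)))) ≡ m *ᶻ z
  lem₁ = solve-∀
  value : ∀ m → + m *ᶻ (1ℤ *ᶻ (-1ℤ *ᶻ (1ℤ *ᶻ T₂ m))) ≡ + m *ᶻ (fac m *ᶻ fac (suc m))
  value zero    = refl
  value (suc a) = trans (cong (λ z → + suc a *ᶻ (1ℤ *ᶻ (-1ℤ *ᶻ (1ℤ *ᶻ z)))) (twisted₁₂-value a)) (lem₁ (+ suc a) _)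
  lem : ∀ m x y → 0ℤ +ᶻ ((0ℤ +ᶻ (-1ℤ *ᶻ (-1ℤ *ᶻ (1ℤ *ᶻ (x *ᶻ y))) +ᶻ 0ℤ)) +ᶻ (m *ᶻ (x *ᶻ y) +ᶻ m *ᶻ 0ℤ)) ≡ ((1ℤ +ᶻ m) *ᶻ x) *ᶻ y
  lem = solve-∀

-- Joining `odd 0 1` to a `B₂₁` would create a second `L`, so `odd 0 1` ends the trail. Then `Y`
-- must be followed by a `B₂₁`, which leaves three loops at vertex 0; the factor 3 is 3! from
-- `closed-loops` over their 2 signed orderings.
twisted-loop-value : ∀ a → + 3 *ᶻ trails 0 1 (edge 0 0 true true ∷ edge 0 1 false false ∷ odd 0 0 ∷ odd 0 1 ∷ bs a (suc a))
    ≡ -1ℤ *ᶻ (fac (suc a) *ᶻ fac (suc (suc (suc a))))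
twisted-loop-value a = begin
  + 3 *ᶻ trails 0 1 (L ∷ Y ∷ odd 0 0 ∷ odd 0 1 ∷ bs a (suc a))
    ≡⟨ cong (+ 3 *ᶻ_) (trans (trails-↝ 0 1 (↝-front (odd 0 1) (L ∷ Y ∷ odd 0 0 ∷ [])))
         (cong (-1ℤ *ᶻ_) (forward-bs 0 1 (odd 0 1) (L ∷ Y ∷ odd 0 0 ∷ []) a (suc a)))) ⟩
  + 3 *ᶻ (-1ℤ *ᶻ (1ℤ *ᶻ ((1ℤ *ᶻ (1ℤ *ᶻ (-1ℤ *ᶻ εs (odd 0 1) (bs a (suc a))))) *ᶻ K)
    +ᶻ (0ℤ +ᶻ (+ a *ᶻ 0ℤ +ᶻ + suc a *ᶻ (1ℤ *ᶻ (1ℤ *ᶻ trails 0 1 (L ∷ L ∷ Y ∷ odd 0 0 ∷ bs a a)))))))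
    ≡⟨ cong₂ (λ y z → + 3 *ᶻ (-1ℤ *ᶻ (1ℤ *ᶻ ((1ℤ *ᶻ (1ℤ *ᶻ (-1ℤ *ᶻ y))) *ᶻ K) +ᶻ (0ℤ +ᶻ (+ a *ᶻ 0ℤ +ᶻ + suc a *ᶻ (1ℤ *ᶻ (1ℤ *ᶻ z)))))))
         (εs-bs-suc (odd 0 1) a) (parallel 0 1 L refl (here refl)) ⟩
  + 3 *ᶻ (-1ℤ *ᶻ (1ℤ *ᶻ (1ℤ *ᶻ K) +ᶻ (0ℤ +ᶻ (+ a *ᶻ 0ℤ +ᶻ + suc a *ᶻ 0ℤ))))
    ≡⟨ lem₁ (+ a) (+ suc a) K ⟩
  -1ℤ *ᶻ (+ 3 *ᶻ K)
    ≡⟨ cong (λ z → -1ℤ *ᶻ (+ 3 *ᶻ z)) (trans (trails-↝ 0 0 (swap L Y)) (cong (1ℤ *ᶻ_) (forward-bs 0 0 Y (L ∷ odd 0 0 ∷ []) a (suc a)))) ⟩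
  -1ℤ *ᶻ (+ 3 *ᶻ (1ℤ *ᶻ (0ℤ +ᶻ (0ℤ +ᶻ (+ a *ᶻ 0ℤ +ᶻ + suc a *ᶻ (1ℤ *ᶻ (1ℤ *ᶻ D)))))))
    ≡⟨ lem₂ (+ a) (+ suc a) D ⟩
  -1ℤ *ᶻ (+ suc a *ᶻ (+ 3 *ᶻ D))
    ≡⟨ cong (-1ℤ *ᶻ_) (trans (cong (+ suc a *ᶻ_) D-value)
         (trans (sym (ℤₚ.*-assoc (+ suc a) (fac a) _)) (cong (_*ᶻ fac (suc (suc (suc a)))) (sym (fac-suc a))))) ⟩
  -1ℤ *ᶻ (fac (suc a) *ᶻ fac (suc (suc (suc a)))) ∎
  where
  L = edge 0 0 true true
  Y = edge 0 1 false false
  M = edge 0 0 true false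
  K = trails 0 0 (L ∷ Y ∷ odd 0 0 ∷ bs a (suc a))
  D = trails 0 0 (M ∷ L ∷ odd 0 0 ∷ bs a a)
  lem₁ : ∀ a b k → + 3 *ᶻ (-1ℤ *ᶻ (1ℤ *ᶻ (1ℤ *ᶻ k) +ᶻ (0ℤ +ᶻ (a *ᶻ 0ℤ +ᶻ b *ᶻ 0ℤ)))) ≡ -1ℤ *ᶻ (+ 3 *ᶻ k)
  lem₁ = solve-∀
  lem₂ : ∀ a b d → -1ℤ *ᶻ (+ 3 *ᶻ (1ℤ *ᶻ (0ℤ +ᶻ (0ℤ +ᶻ (a *ᶻ 0ℤ +ᶻ b *ᶻ (1ℤ *ᶻ (1ℤ *ᶻ d))))))) ≡ -1ℤ *ᶻ (b *ᶻ (+ 3 *ᶻ d))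
  lem₂ = solve-∀
  lem₃ : ∀ d → + 2 *ᶻ (+ 3 *ᶻ d) ≡ + 6 *ᶻ d
  lem₃ = solve-∀
  lem₄ : ∀ x y → x *ᶻ (y *ᶻ + 2) ≡ + 2 *ᶻ (x *ᶻ y)
  lem₄ = solve-∀
  D-value : + 3 *ᶻ D ≡ fac a *ᶻ fac (suc (suc (suc a)))
  D-value = ℤₚ.*-cancelˡ-≡ (+ 2) _ _ (trans (lem₃ D) (trans (closed-loops {M ∷ L ∷ odd 0 0 ∷ []} a (refl ∷ refl ∷ refl ∷ []))
    (trans (cong (λ z → fac a *ᶻ (fac (suc (suc (suc a))) *ᶻ z)) loops-β-βo-o) (lem₄ (fac a) (fac (suc (suc (suc a))))))))

-- The part of S(G₃, B) that does not come from S(G₂, B).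
remainder-value : ∀ m → + 3 *ᶻ trails 0 1 (edge 0 1 false false ∷ odd 1 0 ∷ odd 0 0 ∷ odd 0 1 ∷ bs m m)
     ≡ + (3 + m) *ᶻ (fac m *ᶻ fac (suc (suc m)))
remainder-value m = begin
  + 3 *ᶻ trails 0 1 (Y ∷ odd 1 0 ∷ odd 0 0 ∷ odd 0 1 ∷ bs m m)
    -- The predecessor of `odd 1 0` is `Y`, `odd 0 1` or a `B₁₂`; gluing gives a second `odd 0 0`, a
    -- neutral loop, or the loop of `twisted-loop-value`.
    ≡⟨ cong (+ 3 *ᶻ_) (trans (trails-↝ 0 1 (swap Y (odd 1 0))) (cong (1ℤ *ᶻ_) (backward-bs 0 1 (odd 1 0) (Y ∷ odd 0 0 ∷ odd 0 1 ∷ []) m m))) ⟩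
  + 3 *ᶻ (1ℤ *ᶻ (0ℤ +ᶻ ((1ℤ *ᶻ (1ℤ *ᶻ trails 0 1 (odd 0 0 ∷ odd 0 0 ∷ odd 0 1 ∷ bs m m))
    +ᶻ (0ℤ +ᶻ (-1ℤ *ᶻ (1ℤ *ᶻ (-1ℤ *ᶻ (1ℤ *ᶻ trails 0 1 (evenLoop 0 ∷ Y ∷ odd 0 0 ∷ bs m m)))) +ᶻ 0ℤ)))
    +ᶻ (+ m *ᶻ (1ℤ *ᶻ (-1ℤ *ᶻ (1ℤ *ᶻ T₂ m))) +ᶻ + m *ᶻ 0ℤ))))
    ≡⟨ cong₂ (λ y z → + 3 *ᶻ (1ℤ *ᶻ (0ℤ +ᶻ ((1ℤ *ᶻ (1ℤ *ᶻ y) +ᶻ (0ℤ +ᶻ (-1ℤ *ᶻ (1ℤ *ᶻ (-1ℤ *ᶻ (1ℤ *ᶻ z))) +ᶻ 0ℤ)))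
              +ᶻ (+ m *ᶻ (1ℤ *ᶻ (-1ℤ *ᶻ (1ℤ *ᶻ T₂ m))) +ᶻ + m *ᶻ 0ℤ)))))
         (parallel 0 1 (odd 0 0) refl (here refl))
         (trans (neutral-loop 0 1 0 (Y ∷ odd 0 0 ∷ bs m m))
           (cong₂ (λ y z → (0ℤ +ᶻ (1ℤ +ᶻ (1ℤ +ᶻ y))) *ᶻ z) (outdeg-bs m m) (even₁₂-value m))) ⟩
  + 3 *ᶻ (1ℤ *ᶻ (0ℤ +ᶻ ((1ℤ *ᶻ (1ℤ *ᶻ 0ℤ)
    +ᶻ (0ℤ +ᶻ (-1ℤ *ᶻ (1ℤ *ᶻ (-1ℤ *ᶻ (1ℤ *ᶻ (+ suc (suc m) *ᶻ (fac m *ᶻ fac (suc m)))))) +ᶻ 0ℤ)))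
    +ᶻ (+ m *ᶻ (1ℤ *ᶻ (-1ℤ *ᶻ (1ℤ *ᶻ T₂ m))) +ᶻ + m *ᶻ 0ℤ))))
    ≡⟨ lem₁ (+ m) (+ suc (suc m)) (fac m) (fac (suc m)) (T₂ m) ⟩
  + 3 *ᶻ (fac m *ᶻ (+ suc (suc m) *ᶻ fac (suc m))) +ᶻ -1ℤ *ᶻ (+ m *ᶻ (+ 3 *ᶻ T₂ m))
    ≡⟨ cong₂ (λ y z → + 3 *ᶻ (fac m *ᶻ y) +ᶻ -1ℤ *ᶻ z) (sym (fac-suc (suc m))) (value m) ⟩
  + 3 *ᶻ (fac m *ᶻ fac (suc (suc m))) +ᶻ -1ℤ *ᶻ (+ m *ᶻ (-1ℤ *ᶻ (fac m *ᶻ fac (suc (suc m)))))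
    ≡⟨ lem₂ (+ m) (fac m *ᶻ fac (suc (suc m))) ⟩
  (+ 3 +ᶻ + m) *ᶻ (fac m *ᶻ fac (suc (suc m))) ∎
  where
  Y = edge 0 1 false false
  T₂ : ℕ → ℤ
  T₂ m = trails 0 1 (edge 0 0 true true ∷ Y ∷ odd 0 0 ∷ odd 0 1 ∷ bs (pred m) m)
  value : ∀ m → + m *ᶻ (+ 3 *ᶻ T₂ m) ≡ + m *ᶻ (-1ℤ *ᶻ (fac m *ᶻ fac (suc (suc m))))
  value zero    = refl
  value (suc a) = cong (+ suc a *ᶻ_) (twisted-loop-value a)
  lem₁ : ∀ m n x y z → + 3 *ᶻ (1ℤ *ᶻ (0ℤ +ᶻ ((1ℤ *ᶻ (1ℤ *ᶻ 0ℤ)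
    +ᶻ (0ℤ +ᶻ (-1ℤ *ᶻ (1ℤ *ᶻ (-1ℤ *ᶻ (1ℤ *ᶻ (n *ᶻ (x *ᶻ y))))) +ᶻ 0ℤ)))
    +ᶻ (m *ᶻ (1ℤ *ᶻ (-1ℤ *ᶻ (1ℤ *ᶻ z))) +ᶻ m *ᶻ 0ℤ)))) ≡ + 3 *ᶻ (x *ᶻ (n *ᶻ y)) +ᶻ -1ℤ *ᶻ (m *ᶻ (+ 3 *ᶻ z))
  lem₁ = solve-∀
  lem₂ : ∀ m z → + 3 *ᶻ z +ᶻ -1ℤ *ᶻ (m *ᶻ (-1ℤ *ᶻ z)) ≡ (+ 3 +ᶻ m) *ᶻ z
  lem₂ = solve-∀

-- Elimination of the last vertex

≡ᵇ-refl : ∀ n → (n ≡ᵇ n) ≡ true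
≡ᵇ-refl zero    = refl
≡ᵇ-refl (suc n) = ≡ᵇ-refl n

<⇒≡ᵇ-false : ∀ {m n} → m < n → (m ≡ᵇ n) ≡ false
<⇒≡ᵇ-false {zero}  {suc n} _         = refl
<⇒≡ᵇ-false {suc m} {suc n} (s≤s m<n) = <⇒≡ᵇ-false m<n

-- v stands for the vertex r + 2 and h for the vertex r + 1, counted from 0.
module Eliminate (r : ℕ) {R : List Edge} (free : All (λ e → src e < suc (suc r)) R) where

  v h : ℕ
  v = suc (suc r)
  h = suc r

  -- The trail does not end at `v`, and by `free` no edge of `R` leaves it.
  forward-v : ∀ x hs c → trails 0 1 (edge x v false c ∷ hs ++ R) ≡
    ∑∖ hs (λ f fs → δ (src f) v *ᶻ trails 0 1 (edge x v false c · f ∷ fs ++ R))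
  forward-v x hs c = begin
    trails 0 1 (u ∷ hs ++ R)
      ≡⟨ forward 0 1 u (hs ++ R) ⟩
    0ℤ +ᶻ ∑∖ (hs ++ R) (λ f fs → δ (src f) v *ᶻ trails 0 1 (u · f ∷ fs))
      ≡⟨ trans (ℤₚ.+-identityˡ _) (∑∖-++ hs _) ⟩
    ∑∖ hs _ +ᶻ ∑∖ R (λ f fs → εs f hs *ᶻ (δ (src f) v *ᶻ trails 0 1 (u · f ∷ hs ++ fs)))
      ≡⟨ cong (∑∖ hs (λ f fs → δ (src f) v *ᶻ trails 0 1 (u · f ∷ fs ++ R)) +ᶻ_)
           (∑∖-All-zero free λ f fs f<v →
             trans (cong (λ b → εs f hs *ᶻ ((if b then 1ℤ else 0ℤ) *ᶻ trails 0 1 (u · f ∷ hs ++ fs))) (<⇒≡ᵇ-false f<v)) (ℤₚ.*-zeroʳ (εs f hs))) ⟩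
    ∑∖ hs _ +ᶻ 0ℤ
      ≡⟨ ℤₚ.+-identityʳ _ ⟩
    _ ∎
    where u = edge x v false c

  p q u w e : Edge
  p = odd h v
  q = odd v 0
  u = odd 0 v
  w = odd v h
  e = odd v v

  private
    r≢suc : (r ≡ᵇ suc r) ≡ false
    r≢suc = <⇒≡ᵇ-false (ℕₚ.n<1+n r)

  T : List Edge → ℤ
  T hs = trails 0 1 (hs ++ R)

  join-p : T (p ∷ q ∷ u ∷ w ∷ e ∷ []) ≡
    T (p · q ∷ u ∷ w ∷ e ∷ []) +ᶻ (T (p · w ∷ q ∷ u ∷ e ∷ []) +ᶻ -1ℤ *ᶻ T (p · e ∷ q ∷ u ∷ w ∷ []))
  join-p = trans (forward-v h (q ∷ u ∷ w ∷ e ∷ []) true) expand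
    where
    lem : ∀ a b c → 1ℤ *ᶻ a +ᶻ (0ℤ +ᶻ (-1ℤ *ᶻ (-1ℤ *ᶻ (1ℤ *ᶻ b)) +ᶻ (-1ℤ *ᶻ (-1ℤ *ᶻ (-1ℤ *ᶻ (1ℤ *ᶻ c))) +ᶻ 0ℤ)))
      ≡ a +ᶻ (b +ᶻ -1ℤ *ᶻ c)
    lem = solve-∀
    expand : ∑∖ (q ∷ u ∷ w ∷ e ∷ []) (λ f fs → δ (src f) v *ᶻ T (p · f ∷ fs)) ≡
      T (p · q ∷ u ∷ w ∷ e ∷ []) +ᶻ (T (p · w ∷ q ∷ u ∷ e ∷ []) +ᶻ -1ℤ *ᶻ T (p · e ∷ q ∷ u ∷ w ∷ []))
    expand rewrite ≡ᵇ-refl r = lem (T (p · q ∷ u ∷ w ∷ e ∷ [])) (T (p · w ∷ q ∷ u ∷ e ∷ [])) (T (p · e ∷ q ∷ u ∷ w ∷ []))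

  join-pe : T (p · e ∷ q ∷ u ∷ w ∷ []) ≡ T (odd h 0 ∷ u ∷ w ∷ []) +ᶻ T (odd h h ∷ q ∷ u ∷ [])
  join-pe = trans (forward-v h (q ∷ u ∷ w ∷ []) false) expand
    where
    lem : ∀ a b → 1ℤ *ᶻ a +ᶻ (0ℤ +ᶻ (-1ℤ *ᶻ (-1ℤ *ᶻ (1ℤ *ᶻ b)) +ᶻ 0ℤ)) ≡ a +ᶻ b
    lem = solve-∀
    expand : ∑∖ (q ∷ u ∷ w ∷ []) (λ f fs → δ (src f) v *ᶻ T (p · e · f ∷ fs)) ≡ T (odd h 0 ∷ u ∷ w ∷ []) +ᶻ T (odd h h ∷ q ∷ u ∷ [])
    expand rewrite ≡ᵇ-refl r = lem (T (odd h 0 ∷ u ∷ w ∷ [])) (T (odd h h ∷ q ∷ u ∷ []))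

  -- The loop `e` is the only edge leaving `v`, so nothing can follow it.
  isolated : ∀ x y → T (edge 0 x false false ∷ edge h y false false ∷ e ∷ []) ≡ 0ℤ
  isolated x y = trans (trails-↝ 0 1 (↝-front e (edge 0 x false false ∷ edge h y false false ∷ [])))
    (trans (cong (εs e (edge 0 x false false ∷ edge h y false false ∷ []) *ᶻ_) (trans (forward-v v _ true) expand))
      (ℤₚ.*-zeroʳ (εs e (edge 0 x false false ∷ edge h y false false ∷ []))))
    where
    expand : ∑∖ (edge 0 x false false ∷ edge h y false false ∷ []) (λ f fs → δ (src f) v *ᶻ T (e · f ∷ fs)) ≡ 0ℤ
    expand rewrite r≢suc = refl

  -- Joining `u` directly to `odd v x` would isolate the loop `e`, so `e` must come between them.
  join-u-even : ∀ x y → T (u ∷ edge h y false false ∷ odd v x ∷ e ∷ []) ≡ -1ℤ *ᶻ T (odd 0 x ∷ edge h y false false ∷ [])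
  join-u-even x y = begin
    T (u ∷ n ∷ odd v x ∷ e ∷ [])
      ≡⟨ trans (forward-v 0 (n ∷ odd v x ∷ e ∷ []) true) expand ⟩
    T (edge 0 x false false ∷ n ∷ e ∷ []) +ᶻ -1ℤ *ᶻ T (edge 0 v false false ∷ n ∷ odd v x ∷ [])
      ≡⟨ cong₂ (λ a b → a +ᶻ -1ℤ *ᶻ b) (isolated x y) (trans (forward-v 0 (n ∷ odd v x ∷ []) false) expand′) ⟩
    0ℤ +ᶻ -1ℤ *ᶻ T (odd 0 x ∷ n ∷ [])
      ≡⟨ ℤₚ.+-identityˡ _ ⟩
    -1ℤ *ᶻ T (odd 0 x ∷ n ∷ []) ∎
    where
    n = edge h y false false
    lem : ∀ a b → 0ℤ +ᶻ (1ℤ *ᶻ (1ℤ *ᶻ a) +ᶻ (-1ℤ *ᶻ (1ℤ *ᶻ (1ℤ *ᶻ b)) +ᶻ 0ℤ)) ≡ a +ᶻ -1ℤ *ᶻ b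
    lem = solve-∀
    expand : ∑∖ (n ∷ odd v x ∷ e ∷ []) (λ f fs → δ (src f) v *ᶻ T (u · f ∷ fs)) ≡
      T (edge 0 x false false ∷ n ∷ e ∷ []) +ᶻ -1ℤ *ᶻ T (edge 0 v false false ∷ n ∷ odd v x ∷ [])
    expand rewrite ≡ᵇ-refl r | r≢suc = lem (T (edge 0 x false false ∷ n ∷ e ∷ [])) (T (edge 0 v false false ∷ n ∷ odd v x ∷ []))
    lem′ : ∀ a → 0ℤ +ᶻ (1ℤ *ᶻ (1ℤ *ᶻ a) +ᶻ 0ℤ) ≡ a
    lem′ = solve-∀
    expand′ : ∑∖ (n ∷ odd v x ∷ []) (λ f fs → δ (src f) v *ᶻ T (edge 0 v false false · f ∷ fs)) ≡ T (odd 0 x ∷ n ∷ [])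
    expand′ rewrite ≡ᵇ-refl r | r≢suc = lem′ (T (odd 0 x ∷ n ∷ []))

  join-u-odd : ∀ x y → T (u ∷ odd h y ∷ odd v x ∷ []) ≡ -1ℤ *ᶻ T (edge 0 x false false ∷ odd h y ∷ [])
  join-u-odd x y = trans (forward-v 0 (odd h y ∷ odd v x ∷ []) true) expand
    where
    lem : ∀ a → 0ℤ +ᶻ (-1ℤ *ᶻ (1ℤ *ᶻ a) +ᶻ 0ℤ) ≡ -1ℤ *ᶻ a
    lem = solve-∀
    expand : ∑∖ (odd h y ∷ odd v x ∷ []) (λ f fs → δ (src f) v *ᶻ T (u · f ∷ fs)) ≡ -1ℤ *ᶻ T (edge 0 x false false ∷ odd h y ∷ [])
    expand rewrite ≡ᵇ-refl r | r≢suc = lem (T (edge 0 x false false ∷ odd h y ∷ []))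

  -- The trail passes through `v` twice, entering by `p` and `u` and leaving by `q` and `w`. There
  -- are two ways to match entries with exits, and `e` lies in either passage: four terms.
  eliminate : T (p ∷ q ∷ u ∷ w ∷ e ∷ []) ≡
    T (evenLoop 0 ∷ odd h h ∷ []) +ᶻ (T (odd 0 0 ∷ evenLoop h ∷ [])
    +ᶻ (-1ℤ *ᶻ T (odd 0 h ∷ edge h 0 false false ∷ []) +ᶻ -1ℤ *ᶻ T (edge 0 h false false ∷ odd h 0 ∷ [])))
  eliminate = begin
    T (p ∷ q ∷ u ∷ w ∷ e ∷ [])
      ≡⟨ trans join-p (cong (λ z → T (p · q ∷ u ∷ w ∷ e ∷ []) +ᶻ (T (p · w ∷ q ∷ u ∷ e ∷ []) +ᶻ -1ℤ *ᶻ z)) join-pe) ⟩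
    T (edge h 0 false false ∷ u ∷ w ∷ e ∷ []) +ᶻ (T (evenLoop h ∷ q ∷ u ∷ e ∷ [])
    +ᶻ -1ℤ *ᶻ (T (odd h 0 ∷ u ∷ w ∷ []) +ᶻ T (odd h h ∷ q ∷ u ∷ [])))
      ≡⟨ cong₂ _+ᶻ_ (trans (trails-↝ 0 1 (swap _ u)) (cong (1ℤ *ᶻ_) (join-u-even h 0)))
          (cong₂ (λ a b → a +ᶻ -1ℤ *ᶻ b)
            (trans (trails-↝ 0 1 (↝-front u (evenLoop h ∷ q ∷ []))) (cong (-1ℤ *ᶻ_) (join-u-even 0 h)))
            (cong₂ _+ᶻ_ (trans (trails-↝ 0 1 (swap _ u)) (cong (-1ℤ *ᶻ_) (join-u-odd h 0)))
              (trans (trails-↝ 0 1 (↝-front u (odd h h ∷ q ∷ []))) (cong (1ℤ *ᶻ_) (join-u-odd 0 h))))) ⟩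
    _ ≡⟨ lem (T (evenLoop 0 ∷ odd h h ∷ [])) (T (odd 0 0 ∷ evenLoop h ∷ [])) (T (odd 0 h ∷ edge h 0 false false ∷ []))
           (T (edge 0 h false false ∷ odd h 0 ∷ [])) ⟩
    _ ∎
    where
    lem : ∀ a b c d → 1ℤ *ᶻ (-1ℤ *ᶻ c) +ᶻ (-1ℤ *ᶻ (-1ℤ *ᶻ b) +ᶻ -1ℤ *ᶻ (-1ℤ *ᶻ (-1ℤ *ᶻ d) +ᶻ 1ℤ *ᶻ (-1ℤ *ᶻ a)))
      ≡ a +ᶻ (b +ᶻ (-1ℤ *ᶻ c +ᶻ -1ℤ *ᶻ d))
    lem = solve-∀

block : ℕ → List Edge
block r = odd (suc r) (suc (suc r)) ∷ odd (suc (suc r)) 0 ∷ odd 0 (suc (suc r)) ∷ odd (suc (suc r)) (suc r) ∷ []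

-- The blocks in decreasing order; being neutral, they may be rearranged freely.
blocks : ℕ → List Edge
blocks zero    = []
blocks (suc r) = block r ++ blocks r

rest : ℕ → ℕ → List Edge
rest m r = odd 0 0 ∷ odd 0 1 ∷ blocks r ++ bs m m

-- S(Gₙ, B) for n = 2 + r, see S≡trailsG.
trailsG : ℕ → ℕ → ℤ
trailsG m r = trails 0 1 (odd (suc r) (suc r) ∷ rest m r)

block-neutral : ∀ r → Neutral (block r)
block-neutral r (edge _ _ false false) = refl
block-neutral r (edge _ _ false true)  = refl
block-neutral r (edge _ _ true  false) = refl
block-neutral r (edge _ _ true  true)  = refl

blocks-free : ∀ r → All (λ e → src e < suc (suc r)) (blocks r)
blocks-free zero    = []
blocks-free (suc r) = ℕₚ.m≤n⇒m≤1+n (ℕₚ.≤-refl) ∷ ℕₚ.≤-refl ∷ s≤s z≤n ∷ ℕₚ.≤-refl ∷ All.map ℕₚ.m≤n⇒m≤1+n (blocks-free r)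

bs-free : ∀ a b r → All (λ e → src e < suc (suc r)) (bs a b)
bs-free a b r = Allₚ.++⁺ (Allₚ.replicate⁺ a (s≤s z≤n)) (Allₚ.replicate⁺ b (s≤s (s≤s z≤n)))

rest-free : ∀ m r → All (λ e → src e < suc (suc r)) (rest m r)
rest-free m r = s≤s z≤n ∷ s≤s z≤n ∷ Allₚ.++⁺ (blocks-free r) (bs-free m m r)

outdeg-rest : ∀ m r → outdeg 0 (rest m r) ≡ + (2 + (r + m))
outdeg-rest m r = cong (λ z → 1ℤ +ᶻ (1ℤ +ᶻ z)) (go r)
  where
  go : ∀ r → outdeg 0 (blocks r ++ bs m m) ≡ + (r + m)
  go zero    = outdeg-bs m m
  go (suc r) = trans (lem (outdeg 0 (blocks r ++ bs m m))) (cong (1ℤ +ᶻ_) (go r))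
    where
    lem : ∀ x → 0ℤ +ᶻ (0ℤ +ᶻ (1ℤ +ᶻ (0ℤ +ᶻ x))) ≡ 1ℤ +ᶻ x
    lem = solve-∀

-- Of the four terms, one has a neutral loop at 0, which yields the number of visits; two duplicate
-- `odd 0 0` and `odd 0 h`. The last survives because `odd h 0` need not occur in `rest`.
reduce : ∀ m r → odd 0 (suc r) ∈ˡ rest m r → trailsG m (suc r) ≡
  + (2 + (r + m)) *ᶻ trailsG m r +ᶻ -1ℤ *ᶻ trails 0 1 (edge 0 (suc r) false false ∷ odd (suc r) 0 ∷ rest m r)
reduce m r u∈ = begin
  trailsG m (suc r)
    ≡⟨ trans (trails-↝ 0 1 (↝-neutral (e ∷ odd 0 0 ∷ odd 0 1 ∷ []) (block r) (block-neutral r))) (ℤₚ.*-identityˡ _) ⟩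
  trails 0 1 (p ∷ q ∷ u ∷ w ∷ e ∷ rest m r)
    ≡⟨ eliminate ⟩
  _ ≡⟨ cong₂ _+ᶻ_
         (trans (neutral-loop 0 1 0 (odd h h ∷ rest m r)) (cong (λ z → (0ℤ +ᶻ (0ℤ +ᶻ z)) *ᶻ trailsG m r) (outdeg-rest m r)))
         (cong₂ (λ a b → a +ᶻ (-1ℤ *ᶻ b +ᶻ -1ℤ *ᶻ Z))
           (parallel 0 1 (odd 0 0) refl (there (here refl)))
           (parallel 0 1 (odd 0 h) refl (there u∈))) ⟩
  (0ℤ +ᶻ (0ℤ +ᶻ + (2 + (r + m)))) *ᶻ trailsG m r +ᶻ (0ℤ +ᶻ (-1ℤ *ᶻ 0ℤ +ᶻ -1ℤ *ᶻ Z))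
    ≡⟨ lem (+ (2 + (r + m))) (trailsG m r) Z ⟩
  _ ∎
  where
  open Eliminate r (rest-free m r)
  Z = trails 0 1 (edge 0 h false false ∷ odd h 0 ∷ rest m r)
  lem : ∀ a b z → (0ℤ +ᶻ (0ℤ +ᶻ a)) *ᶻ b +ᶻ (0ℤ +ᶻ (-1ℤ *ᶻ 0ℤ +ᶻ -1ℤ *ᶻ z)) ≡ a *ᶻ b +ᶻ -1ℤ *ᶻ z
  lem = solve-∀

-- The previous vertex now has a block of its own, which contains a second `odd (suc (suc r)) 0`; so
-- the last term of `reduce` vanishes too.
trailsG-suc-suc : ∀ m r → trailsG m (suc (suc r)) ≡ + (3 + (r + m)) *ᶻ trailsG m (suc r)
trailsG-suc-suc m r = trans (reduce m (suc r) (there (there (there (there (here refl))))))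
  (trans (cong (λ z → + (3 + (r + m)) *ᶻ trailsG m (suc r) +ᶻ -1ℤ *ᶻ z)
    (trans (trails-↝ 0 1 (swap (edge 0 (suc (suc r)) false false) (odd (suc (suc r)) 0)))
      (trans (ℤₚ.*-identityˡ _) (parallel 0 1 (odd (suc (suc r)) 0) refl (there (there (there (there (here refl)))))))))
    (ℤₚ.+-identityʳ _))

trailsG-0 : ∀ m → trailsG m 0 ≡ fac (suc m) *ᶻ fac (suc m)
trailsG-0 m = two-vertices m

-- In units of m!(m+2)!, three times the two terms of `reduce` are 3(m+1) and m+3, with difference
-- 2m.
trailsG-1 : ∀ m → + 3 *ᶻ trailsG m 1 ≡ + 2 *ᶻ (+ m *ᶻ (fac (2 + m) *ᶻ fac m))
trailsG-1 m = begin
  + 3 *ᶻ trailsG m 1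
    ≡⟨ cong (+ 3 *ᶻ_) (trans (reduce m 0 (there (here refl))) (cong (λ z → + (2 + m) *ᶻ z +ᶻ -1ℤ *ᶻ Z) (trailsG-0 m))) ⟩
  + 3 *ᶻ (+ (2 + m) *ᶻ (fac (1 + m) *ᶻ fac (1 + m)) +ᶻ -1ℤ *ᶻ Z)
    ≡⟨ lem₁ (+ (2 + m)) (fac (1 + m)) Z ⟩
  + 3 *ᶻ ((+ (2 + m) *ᶻ fac (1 + m)) *ᶻ fac (1 + m)) +ᶻ -1ℤ *ᶻ (+ 3 *ᶻ Z)
    ≡⟨ cong₂ (λ a b → + 3 *ᶻ a +ᶻ -1ℤ *ᶻ b) (cong₂ _*ᶻ_ (sym (fac-suc (1 + m))) (fac-suc m)) (remainder-value m) ⟩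
  + 3 *ᶻ (fac (2 + m) *ᶻ ((1ℤ +ᶻ + m) *ᶻ fac m)) +ᶻ -1ℤ *ᶻ ((+ 3 +ᶻ + m) *ᶻ (fac m *ᶻ fac (2 + m)))
    ≡⟨ lem₂ (+ m) (fac m) (fac (2 + m)) ⟩
  + 2 *ᶻ (+ m *ᶻ (fac (2 + m) *ᶻ fac m)) ∎
  where
  Z = trails 0 1 (edge 0 1 false false ∷ odd 1 0 ∷ rest m 0)
  lem₁ : ∀ a b z → + 3 *ᶻ (a *ᶻ (b *ᶻ b) +ᶻ -1ℤ *ᶻ z) ≡ + 3 *ᶻ ((a *ᶻ b) *ᶻ b) +ᶻ -1ℤ *ᶻ (+ 3 *ᶻ z)
  lem₁ = solve-∀
  lem₂ : ∀ m x y → + 3 *ᶻ (y *ᶻ ((1ℤ +ᶻ m) *ᶻ x)) +ᶻ -1ℤ *ᶻ ((+ 3 +ᶻ m) *ᶻ (x *ᶻ y)) ≡ + 2 *ᶻ (m *ᶻ (y *ᶻ x))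
  lem₂ = solve-∀

trailsG-suc : ∀ m r → + 3 *ᶻ trailsG m (suc r) ≡ + 2 *ᶻ (+ m *ᶻ (fac (2 + (r + m)) *ᶻ fac m))
trailsG-suc m zero    = trailsG-1 m
trailsG-suc m (suc r) = begin
  + 3 *ᶻ trailsG m (suc (suc r))
    ≡⟨ trans (cong (+ 3 *ᶻ_) (trailsG-suc-suc m r)) (*-exchange (+ 3) k _) ⟩
  k *ᶻ (+ 3 *ᶻ trailsG m (suc r))
    ≡⟨ cong (k *ᶻ_) (trailsG-suc m r) ⟩
  k *ᶻ (+ 2 *ᶻ (+ m *ᶻ (fac (2 + (r + m)) *ᶻ fac m)))
    ≡⟨ lem k (+ m) (fac (2 + (r + m))) (fac m) ⟩
  + 2 *ᶻ (+ m *ᶻ ((k *ᶻ fac (2 + (r + m))) *ᶻ fac m))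
    ≡⟨ cong (λ z → + 2 *ᶻ (+ m *ᶻ (z *ᶻ fac m))) (sym (fac-suc (2 + (r + m)))) ⟩
  _ ∎
  where
  k = + (3 + (r + m))
  lem : ∀ k m x y → k *ᶻ (+ 2 *ᶻ (m *ᶻ (x *ᶻ y))) ≡ + 2 *ᶻ (m *ᶻ ((k *ᶻ x) *ᶻ y))
  lem = solve-∀

-- S as a signed count of trails

sum-cong : ∀ {k} {f g : Fin k → ℕ} → (∀ i → f i ≡ g i) → sum f ≡ sum g
sum-cong = sum-cong-≗

⟦_⟧ : Bool → ℕ
⟦ true ⟧  = 1
⟦ false ⟧ = 0

infix 8 _⋖_

_⋖_ : ∀ {k} → Fin k → Fin k → Bool
i ⋖ j = toℕ i <ᵇ toℕ j

∣tabulate∣ : ∀ {k} (f : Fin k → Bool) → ∣ Vec.tabulate f ∣ ≡ sum (⟦_⟧ ∘ f)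
∣tabulate∣ {zero}  f = refl
∣tabulate∣ {suc k} f with f zero
... | true  = cong suc (∣tabulate∣ (f ∘ suc))
... | false = ∣tabulate∣ (f ∘ suc)

sum-allFin : ∀ k (f : Fin k → ℕ) → ℕList.sum (map f (allFin k)) ≡ sum f
sum-allFin k f = trans (cong ℕList.sum (Listₚ.map-tabulate id f)) (go f)
  where
  go : ∀ {k} (f : Fin k → ℕ) → ℕList.sum (List.tabulate f) ≡ sum f
  go {zero}  f = refl
  go {suc k} f = cong₂ _+_ refl (go (f ∘ suc))

-- Indexed by positions along the trail, with `β` tested on the edges found there, so that both
-- signs count over the same pairs.
inversionsIn : ∀ {k} → (Fin k → Bool) → (Fin k → Fin k) → ℕ
inversionsIn β f = sum λ x → sum λ y → ⟦ (x ⋖ y ∧ f y ⋖ f x) ∧ (β (f x) ∧ β (f y)) ⟧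

inversions-sum : ∀ {k} (σ : Permutation′ k) →
  inversions σ ≡ sum λ x → sum λ y → ⟦ x ⋖ y ∧ (σ ⟨$⟩ʳ y) ⋖ (σ ⟨$⟩ʳ x) ⟧
inversions-sum {k} σ = trans (sum-allFin k _) (sum-cong λ x → ∣tabulate∣ (λ y → x ⋖ y ∧ (σ ⟨$⟩ʳ y) ⋖ (σ ⟨$⟩ʳ x)))

inversions-all : ∀ {k} (σ : Permutation′ k) → inversions σ ≡ inversionsIn (λ _ → true) (σ ⟨$⟩ʳ_)
inversions-all σ = trans (inversions-sum σ)
  (sum-cong λ x → sum-cong λ y → cong ⟦_⟧ (sym (Boolₚ.∧-identityʳ (x ⋖ y ∧ (σ ⟨$⟩ʳ y) ⋖ (σ ⟨$⟩ʳ x)))))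

nth-⋖ : ∀ {k} (M : Subset k) g h → nth M g ⋖ nth M h ≡ g ⋖ h
nth-⋖ (inside  ∷ M) zero    zero    = refl
nth-⋖ (inside  ∷ M) zero    (suc h) = refl
nth-⋖ (inside  ∷ M) (suc g) zero    = refl
nth-⋖ (inside  ∷ M) (suc g) (suc h) = nth-⋖ M g h
nth-⋖ (outside ∷ M) g       h       = nth-⋖ M g h

sum-nth : ∀ {k} (M : Subset k) (f : Fin k → ℕ) → sum (f ∘ nth M) ≡ sum λ a → ⟦ Vec.lookup M a ⟧ * f a
sum-nth []            f = refl
sum-nth (inside  ∷ M) f = cong₂ _+_ (sym (ℕₚ.*-identityˡ (f zero))) (sum-nth M (f ∘ suc))
sum-nth (outside ∷ M) f = sum-nth M (f ∘ suc)

↾-⋖ : ∀ {k} (σ : Permutation′ k) (M : Subset k) g h →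
  (σ ↾ M ⟨$⟩ʳ g) ⋖ (σ ↾ M ⟨$⟩ʳ h) ≡ (σ ⟨$⟩ʳ nth M g) ⋖ (σ ⟨$⟩ʳ nth M h)
↾-⋖ σ M g h = does-⇔ (mk⇔ to⇒value value⇒to) (to g Finₚ.<? to h) (value g Finₚ.<? value h)
  where
  open Restriction σ M
  value⇒to : ∀ {g h} → value g Fin.< value h → to g Fin.< to h
  value⇒to {g} {h} lt = ℕₚ.≤-pred (subst₂ _<_ (sym (toℕ-to g)) (sym (toℕ-to h)) (rank-mono lt))
  to⇒value : to g Fin.< to h → value g Fin.< value h
  to⇒value lt with <-cmp (value g) (value h)
  ... | tri< p _ _ = p
  ... | tri≈ _ p _ = contradiction lt (ℕₚ.<-irrefl (cong (toℕ ∘ to) (value-injective p)))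
  ... | tri> _ _ p = contradiction lt (ℕₚ.<-asym (value⇒to p))

-- Restriction keeps the relative order, and an inverted pair of labels for the inverse of σ is an
-- inverted pair of positions for σ; hence the reindexing by σ and the exchange of the two sums.
inversions-↾ : ∀ {k} (σ : Permutation′ k) (M : Subset k) →
  inversions (Perm.flip σ ↾ M) ≡ inversionsIn (Vec.lookup M) (σ ⟨$⟩ʳ_)
inversions-↾ {k} σ M = begin
  inversions (Perm.flip σ ↾ M)
    ≡⟨ inversions-sum (Perm.flip σ ↾ M) ⟩
  (sum λ g → sum λ h → ⟦ g ⋖ h ∧ (Perm.flip σ ↾ M ⟨$⟩ʳ h) ⋖ (Perm.flip σ ↾ M ⟨$⟩ʳ g) ⟧)
    ≡⟨ (sum-cong λ g → sum-cong λ h → cong₂ (λ a b → ⟦ a ∧ b ⟧) (sym (nth-⋖ M g h)) (↾-⋖ (Perm.flip σ) M h g)) ⟩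
  (sum λ g → sum λ h → F (nth M g) (nth M h))
    ≡⟨ (sum-cong λ g → sum-nth M (F (nth M g))) ⟩
  (sum λ g → sum λ b → ⟦ Vec.lookup M b ⟧ * F (nth M g) b)
    ≡⟨ sum-nth M (λ a → sum λ b → ⟦ Vec.lookup M b ⟧ * F a b) ⟩
  (sum λ a → ⟦ Vec.lookup M a ⟧ * sum λ b → ⟦ Vec.lookup M b ⟧ * F a b)
    ≡⟨ (sum-cong λ a → *-distribˡ-sum ⟦ Vec.lookup M a ⟧ (λ b → ⟦ Vec.lookup M b ⟧ * F a b)) ⟩
  (sum λ a → sum λ b → F′ a b)
    ≡⟨ trans (sum-permute _ σ) (sum-cong λ x → sum-permute (F′ (σ ⟨$⟩ʳ x)) σ) ⟩
  (sum λ x → sum λ y → F′ (σ ⟨$⟩ʳ x) (σ ⟨$⟩ʳ y))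
    ≡⟨ ∑-comm (λ x y → F′ (σ ⟨$⟩ʳ x) (σ ⟨$⟩ʳ y)) ⟩
  (sum λ y → sum λ x → F′ (σ ⟨$⟩ʳ x) (σ ⟨$⟩ʳ y))
    ≡⟨ (sum-cong λ y → sum-cong λ x → trans
         (cong₂ (λ a b → m x * (m y * ⟦ (σ ⟨$⟩ʳ x) ⋖ (σ ⟨$⟩ʳ y) ∧ a ⋖ b ⟧)) (Perm.inverseˡ σ) (Perm.inverseˡ σ))
         (lem (Vec.lookup M (σ ⟨$⟩ʳ x)) (Vec.lookup M (σ ⟨$⟩ʳ y)) ((σ ⟨$⟩ʳ x) ⋖ (σ ⟨$⟩ʳ y)) (y ⋖ x))) ⟩
  inversionsIn (Vec.lookup M) (σ ⟨$⟩ʳ_) ∎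
  where
  F F′ : Fin k → Fin k → ℕ
  F a b = ⟦ a ⋖ b ∧ (σ ⟨$⟩ˡ b) ⋖ (σ ⟨$⟩ˡ a) ⟧
  F′ a b = ⟦ Vec.lookup M a ⟧ * (⟦ Vec.lookup M b ⟧ * F a b)
  m : Fin k → ℕ
  m x = ⟦ Vec.lookup M (σ ⟨$⟩ʳ x) ⟧
  lem : ∀ a b p q → ⟦ a ⟧ * (⟦ b ⟧ * ⟦ p ∧ q ⟧) ≡ ⟦ (q ∧ p) ∧ (b ∧ a) ⟧
  lem false b     p     q     = cong ⟦_⟧ (sym (trans (cong ((q ∧ p) ∧_) (Boolₚ.∧-zeroʳ b)) (Boolₚ.∧-zeroʳ _)))
  lem true  false p     q     = cong ⟦_⟧ (sym (Boolₚ.∧-zeroʳ (q ∧ p)))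
  lem true  true  false false = refl
  lem true  true  false true  = refl
  lem true  true  true  false = refl
  lem true  true  true  true  = refl

inversionsIn-cong : ∀ {k} (β : Fin k → Bool) {f g : Fin k → Fin k} → (∀ x → f x ≡ g x) → inversionsIn β f ≡ inversionsIn β g
inversionsIn-cong β eq = sum-cong λ x → sum-cong λ y →
  cong₂ (λ a b → ⟦ (x ⋖ y ∧ b ⋖ a) ∧ (β a ∧ β b) ⟧) (eq x) (eq y)

-- The number of j before i with both `β i` and `β j`: the inversions created by putting i first.
below : ∀ {k} → (Fin k → Bool) → Fin k → ℕ
below β zero    = 0
below β (suc i) = ⟦ β (suc i) ∧ β zero ⟧ + below (β ∘ suc) i

punchIn-⋖ : ∀ {k} (i : Fin (suc k)) a b → punchIn i a ⋖ punchIn i b ≡ a ⋖ b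
punchIn-⋖ zero    a       b       = refl
punchIn-⋖ (suc i) zero    zero    = refl
punchIn-⋖ (suc i) zero    (suc b) = refl
punchIn-⋖ (suc i) (suc a) zero    = refl
punchIn-⋖ (suc i) (suc a) (suc b) = punchIn-⋖ i a b

below-sum : ∀ {k} (β : Fin (suc k) → Bool) i →
  (sum λ l → ⟦ punchIn i l ⋖ i ∧ (β i ∧ β (punchIn i l)) ⟧) ≡ below β i
below-sum {k}     β zero    = sum-replicate-zero k
below-sum {suc k} β (suc i) = cong₂ _+_ refl (below-sum (β ∘ suc) i)

insertion : ∀ {k} → Fin (suc k) → (Fin k → Fin k) → Fin (suc k) → Fin (suc k)
insertion i f zero    = i
insertion i f (suc l) = punchIn i (f l)

insert-zero : ∀ {k} (i : Fin (suc k)) (π : Permutation′ k) x →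
  Perm.insert zero i π ⟨$⟩ʳ x ≡ insertion i (π ⟨$⟩ʳ_) x
insert-zero i π zero    = refl
insert-zero i π (suc l) = Perm.insert-punchIn zero i π l

inversionsIn-insert : ∀ {k} (β : Fin (suc k) → Bool) i (π : Permutation′ k) →
  inversionsIn β (Perm.insert zero i π ⟨$⟩ʳ_) ≡ below β i + inversionsIn (β ∘ punchIn i) (π ⟨$⟩ʳ_)
inversionsIn-insert β i π = trans (inversionsIn-cong β (insert-zero i π)) (cong₂ _+_
  (trans (sym (sum-permute (λ l → ⟦ punchIn i l ⋖ i ∧ (β i ∧ β (punchIn i l)) ⟧) π)) (below-sum β i))
  (sum-cong λ x → sum-cong λ y → cong (λ b → ⟦ (x ⋖ y ∧ b) ∧ (β (punchIn i (π ⟨$⟩ʳ x)) ∧ β (punchIn i (π ⟨$⟩ʳ y))) ⟧)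
    (punchIn-⋖ i (π ⟨$⟩ʳ y) (π ⟨$⟩ʳ x))))

-- Sums over permutations

sumᶻ : List ℤ → ℤ
sumᶻ = foldr _+ᶻ_ 0ℤ

sumᶻ-++ : ∀ xs ys → sumᶻ (xs ++ ys) ≡ sumᶻ xs +ᶻ sumᶻ ys
sumᶻ-++ []       ys = sym (ℤₚ.+-identityˡ _)
sumᶻ-++ (x ∷ xs) ys = trans (cong (x +ᶻ_) (sumᶻ-++ xs ys)) (sym (ℤₚ.+-assoc x _ _))

sumᶻ-* : ∀ {X : Set} c (f : X → ℤ) xs → sumᶻ (map (λ x → c *ᶻ f x) xs) ≡ c *ᶻ sumᶻ (map f xs)
sumᶻ-* c f []       = sym (ℤₚ.*-zeroʳ c)
sumᶻ-* c f (x ∷ xs) = trans (cong (c *ᶻ f x +ᶻ_) (sumᶻ-* c f xs)) (sym (ℤₚ.*-distribˡ-+ c _ _))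

sumᶻ-cartesianProductWith : ∀ {X Y Z : Set} (f : Z → ℤ) (g : X → Y → Z) xs ys →
  sumᶻ (map f (cartesianProductWith g xs ys)) ≡ sumᶻ (map (λ x → sumᶻ (map (f ∘ g x) ys)) xs)
sumᶻ-cartesianProductWith f g []       ys = refl
sumᶻ-cartesianProductWith f g (x ∷ xs) ys = begin
  sumᶻ (map f (map (g x) ys ++ cartesianProductWith g xs ys))
    ≡⟨ cong sumᶻ (Listₚ.map-++ f (map (g x) ys) _) ⟩
  sumᶻ (map f (map (g x) ys) ++ map f (cartesianProductWith g xs ys))
    ≡⟨ sumᶻ-++ (map f (map (g x) ys)) _ ⟩
  sumᶻ (map f (map (g x) ys)) +ᶻ sumᶻ (map f (cartesianProductWith g xs ys))
    ≡⟨ cong₂ _+ᶻ_ (cong sumᶻ (sym (Listₚ.map-∘ ys))) (sumᶻ-cartesianProductWith f g xs ys) ⟩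
  _ ∎

weight : ∀ {k} → (Fin k → Bool) → (Fin k → Fin k) → ℤ
weight β f = (-1ℤ ^ᶻ inversionsIn (λ _ → true) f) *ᶻ (-1ℤ ^ᶻ inversionsIn β f)

pickSign : ∀ {k} → (Fin k → Bool) → Fin k → ℤ
pickSign β i = (-1ℤ ^ᶻ below (λ _ → true) i) *ᶻ (-1ℤ ^ᶻ below β i)

weight-insert : ∀ {k} (β : Fin (suc k) → Bool) i (π : Permutation′ k) →
  weight β (Perm.insert zero i π ⟨$⟩ʳ_) ≡ pickSign β i *ᶻ weight (β ∘ punchIn i) (π ⟨$⟩ʳ_)
weight-insert β i π = trans
  (cong₂ _*ᶻ_ (split (λ _ → true)) (split β))
  (lem (-1ℤ ^ᶻ below (λ _ → true) i) (-1ℤ ^ᶻ inversionsIn (λ _ → true) (π ⟨$⟩ʳ_)) (-1ℤ ^ᶻ below β i) (-1ℤ ^ᶻ inversionsIn (β ∘ punchIn i) (π ⟨$⟩ʳ_)))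
  where
  split : ∀ β → -1ℤ ^ᶻ inversionsIn β (Perm.insert zero i π ⟨$⟩ʳ_) ≡ (-1ℤ ^ᶻ below β i) *ᶻ (-1ℤ ^ᶻ inversionsIn (β ∘ punchIn i) (π ⟨$⟩ʳ_))
  split β = trans (cong (-1ℤ ^ᶻ_) (inversionsIn-insert β i π)) (ℤₚ.^-distribˡ-+-* -1ℤ (below β i) _)
  lem : ∀ a b c d → (a *ᶻ b) *ᶻ (c *ᶻ d) ≡ (a *ᶻ c) *ᶻ (b *ᶻ d)
  lem = solve-∀

-- The grade of a single edge, either in `B` or not, as opposed to the other two grades that gluing
-- produces.
Pure : Edge → Set
Pure e = ω e ≡ not (β e)

-- Passing one more edge gives -1 from the first sign and another -1 from the second if both edges
-- lie in `B`; on single edges this is `ε`.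
pickSign-suc : ∀ {k} (es : Fin (suc k) → Edge) → (∀ i → Pure (es i)) → ∀ i →
  pickSign (β ∘ es) (suc i) ≡ ε (es (suc i)) (es zero) *ᶻ pickSign (β ∘ es ∘ suc) i
pickSign-suc es pure i = trans
  (cong ((-1ℤ *ᶻ (-1ℤ ^ᶻ below (λ _ → true) i)) *ᶻ_) (ℤₚ.^-distribˡ-+-* -1ℤ ⟦ β (es (suc i)) ∧ β (es zero) ⟧ _))
  (trans (lem (-1ℤ ^ᶻ below (λ _ → true) i) (-1ℤ ^ᶻ ⟦ β (es (suc i)) ∧ β (es zero) ⟧) (-1ℤ ^ᶻ below (β ∘ es ∘ suc) i))
    (cong (_*ᶻ pickSign (β ∘ es ∘ suc) i) (ε-pure (es (suc i)) (es zero) (pure (suc i)) (pure zero))))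
  where
  lem : ∀ a b c → (-1ℤ *ᶻ a) *ᶻ (b *ᶻ c) ≡ (-1ℤ *ᶻ b) *ᶻ (a *ᶻ c)
  lem = solve-∀
  ε-pure : ∀ e f → Pure e → Pure f → -1ℤ *ᶻ (-1ℤ ^ᶻ ⟦ β e ∧ β f ⟧) ≡ ε e f
  ε-pure (edge _ _ false _) (edge _ _ false _) refl refl = refl
  ε-pure (edge _ _ false _) (edge _ _ true  _) refl refl = refl
  ε-pure (edge _ _ true  _) (edge _ _ false _) refl refl = refl
  ε-pure (edge _ _ true  _) (edge _ _ true  _) refl refl = refl

∑∖-tabulate : ∀ {k} (es : Fin (suc k) → Edge) → (∀ i → Pure (es i)) → ∀ φ →
  ∑∖ (List.tabulate es) φ ≡ sumᶻ (List.tabulate λ i → pickSign (β ∘ es) i *ᶻ φ (es i) (List.tabulate (es ∘ punchIn i)))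
∑∖-tabulate {zero}  es pure φ = cong (_+ᶻ 0ℤ) (sym (ℤₚ.*-identityˡ (φ (es zero) [])))
∑∖-tabulate {suc k} es pure φ = cong₂ _+ᶻ_ (sym (ℤₚ.*-identityˡ (φ (es zero) (List.tabulate (es ∘ suc)))))
  (trans (∑∖-tabulate (es ∘ suc) (pure ∘ suc) (λ f fs → ε f (es zero) *ᶻ φ f (es zero ∷ fs)))
    (cong sumᶻ (Listₚ.tabulate-cong λ i → trans
      (lem (pickSign (β ∘ es ∘ suc) i) (ε (es (suc i)) (es zero)) (φ (es (suc i)) (List.tabulate (es ∘ punchIn (suc i)))))
      (cong (_*ᶻ φ (es (suc i)) (List.tabulate (es ∘ punchIn (suc i)))) (sym (pickSign-suc es pure i))))))
  where
  lem : ∀ a b c → a *ᶻ (b *ᶻ c) ≡ (b *ᶻ a) *ᶻ c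
  lem = solve-∀

path : ∀ {k} → ℕ → ℕ → (Fin k → Edge) → ℤ
path {zero}  x t f = δ x t
path {suc k} x t f = δ (src (f zero)) x *ᶻ path (tgt (f zero)) t (f ∘ suc)

path-cong : ∀ {k} x t {f g : Fin k → Edge} → (∀ i → f i ≡ g i) → path x t f ≡ path x t g
path-cong {zero}  x t eq = refl
path-cong {suc k} x t {f} {g} eq = cong₂ _*ᶻ_ (cong (λ e → δ (src e) x) (eq zero))
  (trans (path-cong (tgt (f zero)) t (eq ∘ suc)) (cong (λ e → path (tgt e) t (g ∘ suc)) (eq zero)))

-- Inserting i at position zero means choosing edge i as the first edge and ordering the others,
-- which is the recursion of `trailsₖ`.
∑-permutations : ∀ k (es : Fin k → Edge) → (∀ i → Pure (es i)) → ∀ x t →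
  sumᶻ (map (λ σ → weight (β ∘ es) (σ ⟨$⟩ʳ_) *ᶻ path x t (es ∘ (σ ⟨$⟩ʳ_))) (permutations k))
  ≡ trailsₖ k x t (List.tabulate es)
∑-permutations zero    es pure x t = trans (ℤₚ.+-identityʳ _) (ℤₚ.*-identityˡ _)
∑-permutations (suc k) es pure x t = begin
  sumᶻ (map F (cartesianProductWith (Perm.insert zero) (allFin (suc k)) (permutations k)))
    ≡⟨ sumᶻ-cartesianProductWith F (Perm.insert zero) (allFin (suc k)) (permutations k) ⟩
  sumᶻ (map (λ i → sumᶻ (map (F ∘ Perm.insert zero i) (permutations k))) (allFin (suc k)))
    ≡⟨ cong sumᶻ (Listₚ.map-tabulate id (λ i → sumᶻ (map (F ∘ Perm.insert zero i) (permutations k)))) ⟩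
  sumᶻ (List.tabulate λ i → sumᶻ (map (F ∘ Perm.insert zero i) (permutations k)))
    ≡⟨ cong sumᶻ (Listₚ.tabulate-cong λ i → begin
         sumᶻ (map (F ∘ Perm.insert zero i) (permutations k))
           ≡⟨ cong sumᶻ (Listₚ.map-cong (λ π → trans
                (cong₂ _*ᶻ_ (weight-insert (β ∘ es) i π)
                  (path-cong x t {g = es ∘ insertion i (π ⟨$⟩ʳ_)} λ j → cong es (insert-zero i π j)))
                (lem (pickSign (β ∘ es) i) (weight (β ∘ es ∘ punchIn i) (π ⟨$⟩ʳ_)) (δ (src (es i)) x) _)) (permutations k)) ⟩
         sumᶻ (map (λ π → (pickSign (β ∘ es) i *ᶻ δ (src (es i)) x) *ᶻ F′ i π) (permutations k))
           ≡⟨ sumᶻ-* (pickSign (β ∘ es) i *ᶻ δ (src (es i)) x) (F′ i) (permutations k) ⟩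
         (pickSign (β ∘ es) i *ᶻ δ (src (es i)) x) *ᶻ sumᶻ (map (F′ i) (permutations k))
           ≡⟨ cong ((pickSign (β ∘ es) i *ᶻ δ (src (es i)) x) *ᶻ_)
                (∑-permutations k (es ∘ punchIn i) (pure ∘ punchIn i) (tgt (es i)) t) ⟩
         (pickSign (β ∘ es) i *ᶻ δ (src (es i)) x) *ᶻ trailsₖ k (tgt (es i)) t (List.tabulate (es ∘ punchIn i))
           ≡⟨ ℤₚ.*-assoc (pickSign (β ∘ es) i) _ _ ⟩
         pickSign (β ∘ es) i *ᶻ (δ (src (es i)) x *ᶻ trailsₖ k (tgt (es i)) t (List.tabulate (es ∘ punchIn i))) ∎) ⟩
  sumᶻ (List.tabulate λ i → pickSign (β ∘ es) i *ᶻ (δ (src (es i)) x *ᶻ trailsₖ k (tgt (es i)) t (List.tabulate (es ∘ punchIn i))))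
    ≡⟨ ∑∖-tabulate es pure (λ f fs → δ (src f) x *ᶻ trailsₖ k (tgt f) t fs) ⟨
  trailsₖ (suc k) x t (List.tabulate es) ∎
  where
  F : Permutation′ (suc k) → ℤ
  F σ = weight (β ∘ es) (σ ⟨$⟩ʳ_) *ᶻ path x t (es ∘ (σ ⟨$⟩ʳ_))
  F′ : Fin (suc k) → Permutation′ k → ℤ
  F′ i π = weight (β ∘ es ∘ punchIn i) (π ⟨$⟩ʳ_) *ᶻ path (tgt (es i)) t (es ∘ punchIn i ∘ (π ⟨$⟩ʳ_))
  lem : ∀ a b c d → (a *ᶻ b) *ᶻ (c *ᶻ d) ≡ (a *ᶻ c) *ᶻ (b *ᶻ d)
  lem = solve-∀

IsPath : ∀ {k} → ℕ → ℕ → (Fin k → Edge) → Set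
IsPath {k} x t f = (∀ j → toℕ j ≡ 0 → src (f j) ≡ x)
                 × (∀ j → suc (toℕ j) ≡ k → tgt (f j) ≡ t)
                 × (∀ i j → toℕ j ≡ suc (toℕ i) → src (f j) ≡ tgt (f i))

δ-cases : ∀ a b → (a ≡ b × δ a b ≡ 1ℤ) ⊎ (a ≢ b × δ a b ≡ 0ℤ)
δ-cases zero    zero    = inj₁ (refl , refl)
δ-cases zero    (suc b) = inj₂ ((λ ()) , refl)
δ-cases (suc a) zero    = inj₂ ((λ ()) , refl)
δ-cases (suc a) (suc b) with δ-cases a b
... | inj₁ (p , q) = inj₁ (cong suc p , q)
... | inj₂ (p , q) = inj₂ (p ∘ ℕₚ.suc-injective , q)

-- At least one edge is required: without edges `IsPath` holds vacuously, while `path` still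
-- compares `x` with `t`.
path-cases : ∀ {k} x t (f : Fin (suc k) → Edge) → (IsPath x t f × path x t f ≡ 1ℤ) ⊎ (¬ IsPath x t f × path x t f ≡ 0ℤ)
path-cases {k} x t f with δ-cases (src (f zero)) x
path-cases {k} x t f | inj₂ (≢x , eq) = inj₂ ((λ (start , _) → ≢x (start zero refl)) , cong (_*ᶻ path (tgt (f zero)) t (f ∘ suc)) eq)
path-cases {zero} x t f | inj₁ (≡x , eq) with δ-cases (tgt (f zero)) t
... | inj₁ (≡t , eq′) = inj₁ (((λ { zero _ → ≡x }) , (λ { zero _ → ≡t }) , λ { zero zero () }) , cong₂ _*ᶻ_ eq eq′)
... | inj₂ (≢t , eq′) = inj₂ ((λ (_ , end , _) → ≢t (end zero refl)) , cong₂ _*ᶻ_ eq eq′)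
path-cases {suc k} x t f | inj₁ (≡x , eq) with path-cases (tgt (f zero)) t (f ∘ suc)
... | inj₁ ((start , end , step) , eq′) = inj₁
  ( ( (λ { zero _ → ≡x })
    , (λ { (suc j) p → end j (ℕₚ.suc-injective p) })
    , (λ { zero (suc j) p → start j (ℕₚ.suc-injective p) ; (suc i) (suc j) p → step i j (ℕₚ.suc-injective p) }))
  , cong₂ _*ᶻ_ eq eq′)
... | inj₂ (¬tail , eq′) = inj₂
  ( (λ (start , end , step) → ¬tail ((λ { zero _ → step zero (suc zero) refl })
                                    , (λ j p → end (suc j) (cong suc p))
                                    , (λ i j p → step (suc i) (suc j) (cong suc p))))
  , cong₂ _*ᶻ_ eq eq′)

sumᶻ-filter : ∀ {X : Set} {Q : X → Set} (Q? : Decidable Q) (f g : X → ℤ) →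
  (∀ x → (Q x × g x ≡ 1ℤ) ⊎ (¬ Q x × g x ≡ 0ℤ)) → ∀ xs →
  sumᶻ (map f (filter Q? xs)) ≡ sumᶻ (map (λ x → f x *ᶻ g x) xs)
sumᶻ-filter Q? f g cases []       = refl
sumᶻ-filter Q? f g cases (x ∷ xs) with Q? x | cases x
... | yes q | inj₁ (_ , eq) = cong₂ _+ᶻ_ (sym (trans (cong (f x *ᶻ_) eq) (ℤₚ.*-identityʳ (f x)))) (sumᶻ-filter Q? f g cases xs)
... | yes q | inj₂ (¬q , _) = contradiction q ¬q
... | no ¬q | inj₁ (q , _)  = contradiction q ¬q
... | no ¬q | inj₂ (_ , eq) = trans (sumᶻ-filter Q? f g cases xs)
  (sym (trans (cong (_+ᶻ sumᶻ (map (λ y → f y *ᶻ g y) xs)) (trans (cong (f x *ᶻ_) eq) (ℤₚ.*-zeroʳ (f x)))) (ℤₚ.+-identityˡ _)))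

module _ (G : DoublyRootedDigraph) (M : Subset (DoublyRootedDigraph.#A G)) where

  open DoublyRootedDigraph G

  edgeOf : Fin #A → Edge
  edgeOf i = edge (toℕ (source i)) (toℕ (target i)) (Vec.lookup M i) (not (Vec.lookup M i))

  opaque
    unfolding trails

    S≡trails : 0 < #A → S G M ≡ trails (toℕ s) (toℕ t) (List.tabulate edgeOf)
    S≡trails 0<#A = begin
      S G M
        ≡⟨ sumᶻ-filter (P? G) _ (λ σ → path (toℕ s) (toℕ t) (edgeOf ∘ (σ ⟨$⟩ʳ_))) (cases 0<#A) (permutations #A) ⟩
      sumᶻ (map (λ σ → (sgn σ *ᶻ sgn (Perm.flip σ ↾ M)) *ᶻ path (toℕ s) (toℕ t) (edgeOf ∘ (σ ⟨$⟩ʳ_))) (permutations #A))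
        ≡⟨ cong sumᶻ (Listₚ.map-cong (λ σ → cong (_*ᶻ path (toℕ s) (toℕ t) (edgeOf ∘ (σ ⟨$⟩ʳ_)))
             (cong₂ (λ a b → (-1ℤ ^ᶻ a) *ᶻ (-1ℤ ^ᶻ b)) (inversions-all σ) (inversions-↾ σ M))) (permutations #A)) ⟩
      sumᶻ (map (λ σ → weight (β ∘ edgeOf) (σ ⟨$⟩ʳ_) *ᶻ path (toℕ s) (toℕ t) (edgeOf ∘ (σ ⟨$⟩ʳ_))) (permutations #A))
        ≡⟨ ∑-permutations #A edgeOf (λ _ → refl) (toℕ s) (toℕ t) ⟩
      trailsₖ #A (toℕ s) (toℕ t) (List.tabulate edgeOf)
        ≡⟨ cong (λ k → trailsₖ k (toℕ s) (toℕ t) (List.tabulate edgeOf)) (Listₚ.length-tabulate edgeOf) ⟨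
      trails (toℕ s) (toℕ t) (List.tabulate edgeOf) ∎
      where
      convert : ∀ σ → IsPath (toℕ s) (toℕ t) (edgeOf ∘ (σ ⟨$⟩ʳ_)) → P G σ
      convert σ (start , end , step) = (λ j p → Finₚ.toℕ-injective (start j p)) , (λ j p → Finₚ.toℕ-injective (end j p))
        , (λ i j p → Finₚ.toℕ-injective (step i j p))
      convert′ : ∀ σ → P G σ → IsPath (toℕ s) (toℕ t) (edgeOf ∘ (σ ⟨$⟩ʳ_))
      convert′ σ (start , end , step) = (λ j p → cong toℕ (start j p)) , (λ j p → cong toℕ (end j p))
        , (λ i j p → cong toℕ (step i j p))
      positive : ∀ {k} → 0 < k → ∀ x t (f : Fin k → Edge) → (IsPath x t f × path x t f ≡ 1ℤ) ⊎ (¬ IsPath x t f × path x t f ≡ 0ℤ)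
      positive (s≤s _) = path-cases
      cases : 0 < #A → ∀ σ → (P G σ × path (toℕ s) (toℕ t) (edgeOf ∘ (σ ⟨$⟩ʳ_)) ≡ 1ℤ) ⊎ (¬ P G σ × path (toℕ s) (toℕ t) (edgeOf ∘ (σ ⟨$⟩ʳ_)) ≡ 0ℤ)
      cases 0<#A σ with positive 0<#A (toℕ s) (toℕ t) (edgeOf ∘ (σ ⟨$⟩ʳ_))
      ... | inj₁ (p , eq)  = inj₁ (convert σ p , eq)
      ... | inj₂ (¬p , eq) = inj₂ (¬p ∘ convert′ σ , eq)

-- The digraphs Gₙ

module _ {V : ℕ} where

  coloured : Fin V × Fin V → Bool → Edge
  coloured (i , j) b = edge (toℕ i) (toℕ j) b (not b)

  label : ∀ {k} → ℕ → Vec (Fin V × Fin V) k → List Edge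
  label n       []      = []
  label zero    (e ∷ v) = coloured e false ∷ label zero v
  label (suc n) (e ∷ v) = coloured e true ∷ label n v

  tabulate-label : ∀ {k} n (v : Vec (Fin V × Fin V) k) →
    List.tabulate (λ i → coloured (Vec.lookup v i) (toℕ i <ᵇ n)) ≡ label n v
  tabulate-label n       []      = refl
  tabulate-label zero    (e ∷ v) = cong (coloured e false ∷_) (tabulate-label zero v)
  tabulate-label (suc n) (e ∷ v) = cong (coloured e true ∷_) (tabulate-label n v)

  label-++ : ∀ {k l} (v : Vec (Fin V × Fin V) k) (w : Vec (Fin V × Fin V) l) →
    label 0 (v Vec.++ w) ≡ label 0 v ++ label 0 w
  label-++ []      w = refl
  label-++ (e ∷ v) w = cong (coloured e false ∷_) (label-++ v w)

  label-concat : ∀ {k l} (g : Fin k → Vec (Fin V × Fin V) l) →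
    label 0 (Vec.concat (Vec.tabulate g)) ≡ List.concat (List.tabulate (label 0 ∘ g))
  label-concat {zero}  g = refl
  label-concat {suc k} g = trans (label-++ (g zero) _) (cong (label 0 (g zero) ++_) (label-concat (g ∘ suc)))

alternating : ℕ → List Edge
alternating zero    = []
alternating (suc m) = B₁₂ ∷ B₂₁ ∷ alternating m

label-alternating : ∀ {V k} m (w : Vec (Fin (2 + V) × Fin (2 + V)) k) →
  label (m * 2) (Vec.concat (Vec.replicate m ((zero , suc zero) ∷ (suc zero , zero) ∷ [])) Vec.++ w) ≡ alternating m ++ label 0 w
label-alternating zero    w = refl
label-alternating (suc m) w = cong (λ es → B₁₂ ∷ B₂₁ ∷ es) (label-alternating m w)

ascending : ℕ → List Edge
ascending r = List.concat (List.tabulate {n = r} (block ∘ toℕ))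

label-edges : ∀ m r → label (m * 2) (edges m r) ≡ alternating m ++ odd 0 0 ∷ odd 0 1 ∷ ascending r ++ odd (suc r) (suc r) ∷ []
label-edges m r = trans (label-alternating m _) (cong (λ es → alternating m ++ odd 0 0 ∷ odd 0 1 ∷ es)
  (trans (label-++ (Vec.concat (Vec.tabulate g)) _) (cong₂ _++_
    (trans (label-concat g) (cong List.concat (Listₚ.tabulate-cong {f = label 0 ∘ g} {g = block ∘ toℕ} λ i →
      cong (λ x → odd (suc x) (suc (suc (toℕ i))) ∷ odd (suc (suc (toℕ i))) 0 ∷ odd 0 (suc (suc (toℕ i))) ∷ odd (suc (suc (toℕ i))) (suc x) ∷ [])
        (Finₚ.toℕ-inject₁ i))))
    (cong (λ x → odd (suc x) (suc x) ∷ []) (Finₚ.toℕ-fromℕ r)))))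
  where
  g : Fin r → Vec (Fin (2 + r) × Fin (2 + r)) 4
  g i = (suc (inject₁ i) , suc (suc i)) ∷ (suc (suc i) , zero) ∷ (zero , suc (suc i)) ∷ (suc (suc i) , suc (inject₁ i)) ∷ []

concat-tabulate-suc : ∀ r (h : ℕ → List Edge) →
  List.concat (List.tabulate {n = suc r} (h ∘ toℕ)) ≡ List.concat (List.tabulate {n = r} (h ∘ toℕ)) ++ h r
concat-tabulate-suc zero    h = Listₚ.++-identityʳ (h 0)
concat-tabulate-suc (suc r) h = trans (cong (h 0 ++_) (concat-tabulate-suc r (h ∘ suc))) (sym (Listₚ.++-assoc (h 0) _ _))

ascending↝blocks : ∀ r {es} → ascending r ++ es ↝[ 1ℤ ] blocks r ++ es
ascending↝blocks zero    = done
ascending↝blocks (suc r) {es} = subst₂ (λ xs ys → xs ↝[ 1ℤ ] ys)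
  (trans (sym (Listₚ.++-assoc (ascending r) (block r) es)) (cong (_++ es) (sym (concat-tabulate-suc r block))))
  (sym (Listₚ.++-assoc (block r) (blocks r) es))
  (↝-neutral (ascending r) (block r) (block-neutral r) then ↝-skips (block r) (ascending↝blocks r))

blocks-neutral : ∀ r → Neutral (blocks r)
blocks-neutral zero    f = refl
blocks-neutral (suc r) f = trans (εs-++ f (block r) (blocks r)) (cong₂ _*ᶻ_ (block-neutral r f) (blocks-neutral r f))

alternating-neutral : ∀ m → Neutral (alternating m)
alternating-neutral zero    f = refl
alternating-neutral (suc m) f = trans (sym (ℤₚ.*-assoc (ε f B₁₂) (ε f B₂₁) _)) (cong₂ _*ᶻ_ (ε² f B₁₂) (alternating-neutral m f))

alternating↝bs : ∀ m → alternating m ↝[ 1ℤ ] bs m m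
alternating↝bs zero    = done
alternating↝bs (suc m) = skip B₁₂ (skip B₂₁ (alternating↝bs m) then ↝-resp (signs m) (↝-back B₂₁ (replicate m B₁₂)))
  where
  signs : ∀ m → εs B₂₁ (replicate m B₁₂) ≡ 1ℤ
  signs zero    = refl
  signs (suc m) = trans (ℤₚ.*-identityˡ _) (signs m)

-- No sign remains: the edges of `B` together and the blocks are neutral, and otherwise the last
-- loop passes only the two edges `odd 0 0` and `odd 0 1`, with sign -1 each.
trails-edges : ∀ m r →
  trails 0 1 (alternating m ++ odd 0 0 ∷ odd 0 1 ∷ ascending r ++ odd (suc r) (suc r) ∷ []) ≡ trailsG m r
trails-edges m r = begin
  trails 0 1 (alternating m ++ Q)
    ≡⟨ cong (λ es → trails 0 1 (alternating m ++ es)) (Listₚ.++-identityʳ Q) ⟨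
  trails 0 1 (alternating m ++ Q ++ [])
    ≡⟨ trans (trails-↝ 0 1 (↝-neutral Q (alternating m) (alternating-neutral m))) (ℤₚ.*-identityˡ _) ⟨
  trails 0 1 (Q ++ alternating m ++ [])
    ≡⟨ cong (trails 0 1) (trans (cong (Q ++_) (Listₚ.++-identityʳ (alternating m)))
         (cong (λ es → odd 0 0 ∷ odd 0 1 ∷ es) (Listₚ.++-assoc (ascending r) (loop ∷ []) (alternating m)))) ⟩
  trails 0 1 (odd 0 0 ∷ odd 0 1 ∷ ascending r ++ loop ∷ alternating m)
    ≡⟨ trails-↝ 0 1 (skip (odd 0 0) (skip (odd 0 1) (↝-skips (ascending r) (skip loop (alternating↝bs m)) then ascending↝blocks r))
         then ↝-front loop (odd 0 0 ∷ odd 0 1 ∷ blocks r)) ⟩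
  (1ℤ *ᶻ (-1ℤ *ᶻ (-1ℤ *ᶻ εs loop (blocks r)))) *ᶻ trailsG m r
    ≡⟨ cong (λ s → (1ℤ *ᶻ (-1ℤ *ᶻ (-1ℤ *ᶻ s))) *ᶻ trailsG m r) (blocks-neutral r loop) ⟩
  1ℤ *ᶻ trailsG m r
    ≡⟨ ℤₚ.*-identityˡ _ ⟩
  trailsG m r ∎
  where
  loop = odd (suc r) (suc r)
  Q = odd 0 0 ∷ odd 0 1 ∷ ascending r ++ loop ∷ []

S≡trailsG : ∀ m r → S (Gₙ m (2 + r)) (firstEdges (Gₙ m (2 + r)) (2 * m)) ≡ trailsG m r
S≡trailsG m r = begin
  S G M
    ≡⟨ S≡trails G M (ℕₚ.≤-trans (s≤s z≤n) (ℕₚ.m≤n+m (2 + (r * 4 + 1)) (m * 2))) ⟩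
  trails 0 1 (List.tabulate (edgeOf G M))
    ≡⟨ cong (trails 0 1) (Listₚ.tabulate-cong λ i → cong (coloured (Vec.lookup (edges m r) i)) (trans
         (Vecₚ.lookup∘tabulate (λ i → toℕ i <ᵇ 2 * m) i) (cong (toℕ i <ᵇ_) (ℕₚ.*-comm 2 m)))) ⟩
  trails 0 1 (List.tabulate (λ i → coloured (Vec.lookup (edges m r) i) (toℕ i <ᵇ m * 2)))
    ≡⟨ cong (trails 0 1) (trans (tabulate-label (m * 2) (edges m r)) (label-edges m r)) ⟩
  trails 0 1 (alternating m ++ odd 0 0 ∷ odd 0 1 ∷ ascending r ++ odd (suc r) (suc r) ∷ [])
    ≡⟨ trails-edges m r ⟩
  trailsG m r ∎
  where
  G = Gₙ m (2 + r)
  M = firstEdges G (2 * m)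

/-two-thirds : ∀ i j → + 3 *ᶻ i ≡ + 2 *ᶻ j → i ℚ./ 1 ≡ (+ 2 ℚ./ 3) ℚ.* (j ℚ./ 1)
/-two-thirds i j eq = ℚₚ.toℚᵘ-injective (begin-equality
  ℚ.toℚᵘ (i ℚ./ 1)
    ≃⟨ ℚₚ.toℚᵘ-fromℚᵘ (ℚᵘ.mkℚᵘ i 0) ⟩
  ℚᵘ.mkℚᵘ i 0
    ≃⟨ ℚᵘ.*≡* (trans (ℤₚ.*-comm i (+ 3)) (trans eq (sym (ℤₚ.*-identityʳ _)))) ⟩
  ℚᵘ.mkℚᵘ (+ 2) 2 ℚᵘ.* ℚᵘ.mkℚᵘ j 0
    ≃⟨ ℚᵘₚ.*-cong (ℚₚ.toℚᵘ-fromℚᵘ (ℚᵘ.mkℚᵘ (+ 2) 2)) (ℚₚ.toℚᵘ-fromℚᵘ (ℚᵘ.mkℚᵘ j 0)) ⟨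
  ℚ.toℚᵘ (+ 2 ℚ./ 3) ℚᵘ.* ℚ.toℚᵘ (j ℚ./ 1)
    ≃⟨ ℚₚ.toℚᵘ-homo-* (+ 2 ℚ./ 3) (j ℚ./ 1) ⟨
  ℚ.toℚᵘ ((+ 2 ℚ./ 3) ℚ.* (j ℚ./ 1)) ∎ᵘ)
  where open ℚᵘₚ.≤-Reasoning using (begin-equality_; step-≃-⟩; step-≃-⟨) renaming (_∎ to _∎ᵘ)

theorem3p1 : (m̄ : ℕ) .{{_ : NonZero m̄}} (n : ℕ) .{{_ : NonTrivial n}} →
    let G = Gₙ m̄ n
        B = firstEdges G (2 * m̄)
    in (n ≡ 2 → S G B ≡ + (((m̄ + 1) !) ^ 2))
     × (n ≥ 3 → S G B ℚ./ 1 ≡ (+ 2 ℚ./ 3) ℚ.* (+ (m̄ * (m̄ + n ∸ 1) ! * m̄ !) ℚ./ 1))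
theorem3p1 m (suc (suc r)) = first , second
  where
  first : suc (suc r) ≡ 2 → S (Gₙ m (2 + r)) (firstEdges (Gₙ m (2 + r)) (2 * m)) ≡ + (((m + 1) !) ^ 2)
  first refl = begin
    _ ≡⟨ trans (S≡trailsG m 0) (trailsG-0 m) ⟩
    fac (suc m) *ᶻ fac (suc m)
      ≡⟨ ℤₚ.pos-* (suc m !) (suc m !) ⟨
    + (suc m ! * suc m !)
      ≡⟨ cong (λ k → + (k * k)) (cong _! (ℕₚ.+-comm 1 m)) ⟩
    + ((m + 1) ! * (m + 1) !)
      ≡⟨ cong (λ k → + ((m + 1) ! * k)) (ℕₚ.*-identityʳ ((m + 1) !)) ⟨
    + (((m + 1) !) ^ 2) ∎
  second : suc (suc r) ≥ 3 → S (Gₙ m (2 + r)) (firstEdges (Gₙ m (2 + r)) (2 * m)) ℚ./ 1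
    ≡ (+ 2 ℚ./ 3) ℚ.* (+ (m * (m + suc (suc r) ∸ 1) ! * m !) ℚ./ 1)
  second (s≤s (s≤s (s≤s {n = r′} _))) = /-two-thirds (S (Gₙ m (3 + r′)) (firstEdges (Gₙ m (3 + r′)) (2 * m))) (+ (m * (m + (3 + r′) ∸ 1) ! * m !)) (begin
    + 3 *ᶻ S (Gₙ m (3 + r′)) (firstEdges (Gₙ m (3 + r′)) (2 * m))
      ≡⟨ cong (+ 3 *ᶻ_) (S≡trailsG m (suc r′)) ⟩
    + 3 *ᶻ trailsG m (suc r′)
      ≡⟨ trailsG-suc m r′ ⟩
    + 2 *ᶻ (+ m *ᶻ (fac (2 + (r′ + m)) *ᶻ fac m))
      ≡⟨ cong (+ 2 *ᶻ_) (trans (sym (ℤₚ.*-assoc (+ m) (fac (2 + (r′ + m))) (fac m)))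
           (trans (cong (_*ᶻ fac m) (sym (ℤₚ.pos-* m ((2 + (r′ + m)) !)))) (sym (ℤₚ.pos-* (m * (2 + (r′ + m)) !) (m !))))) ⟩
    + 2 *ᶻ + (m * (2 + (r′ + m)) ! * m !)
      ≡⟨ cong (λ k → + 2 *ᶻ + (m * k ! * m !)) (cong (_∸ 1) (ℕₚ.+-comm (3 + r′) m)) ⟩
    + 2 *ᶻ + (m * (m + (3 + r′) ∸ 1) ! * m !) ∎)
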